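{- For every integer $n\ge 0$, the number of $n$-step basketball walks from $0$ to $1$ that are positive except at the origin is equal to the number of $n$-vertex increasing unary-binary trees whose associated permutation avoids the pattern $213$.
   Context: A basketball walk is a finite sequence of integers $(w_0,\ldots,w_n)$ with $w_0=0$ and each step $w_i-w_{i-1}\in\{ -2,-1,+1,+2\}$; "from $0$ to $1$, positive except at the origin" means $w_n=1$ and $w_i>0$ for $1\le i\le n$. A unary-binary tree of size $n\ge1$ is a rooted plane tree with $n$ vertices in which every vertex has $0$, $1$ or $2$ children (so there are no such trees with $0$ vertices). It is increasing if its vertices are bijectively labeled by $1,\ldots,n$ so that every non-root vertex has a label larger than that of its parent. The associated permutation of an increasing tree is the sequence of labels read in breadth-first search order, from left to right within each generation. A permutation $\sigma=(\sigma_1,\ldots,\sigma_n)$ avoids $213$ if there are no indices $i_1<i_2<i_3$ with $\sigma_{i_2}<\sigma_{i_1}<\sigma_{i_3}$. -}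

module Defs where

open import Data.Bool using (Bool; true; false; _∧_; _∨_; not; T)
open import Data.Nat using (ℕ; zero; suc; _+_; _<ᵇ_; _≡ᵇ_)
open import Data.Integer as ℤ using (ℤ; +_; -[1+_])
open import Data.List using (List; []; _∷_; _++_; length; concatMap; map; upTo)
open import Data.Bool.ListAction using (all; any)
open import Data.Vec using (Vec; []; _∷_)
open import Data.Product using (Σ; _×_)
open import Relation.Nullary.Decidable using (⌊_⌋)
open import Function.Bundles using (_↔_)

-- Basketball walks
-- A walk of n steps is given by its sequence of steps, each in {-2,-1,+1,+2};
-- the positions are w_0 = 0 and w_i = w_{i-1} + step_i.

data Step : Set where
  down2 down1 up1 up2 : Step

stepVal : Step → ℤ
stepVal down2 = -[1+ 1 ]
stepVal down1 = -[1+ 0 ]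
stepVal up1   = + 1
stepVal up2   = + 2

positiveTo1From : {n : ℕ} → ℤ → Vec Step n → Bool
positiveTo1From w []       = ⌊ w ℤ.≟ + 1 ⌋
positiveTo1From w (s ∷ ss) =
  ⌊ + 0 ℤ.<? (w ℤ.+ stepVal s) ⌋ ∧ positiveTo1From (w ℤ.+ stepVal s) ss

PositiveWalk0to1 : {n : ℕ} → Vec Step n → Set
PositiveWalk0to1 ss = T (positiveTo1From (+ 0) ss)

BasketballExcursion : ℕ → Set
BasketballExcursion n = Σ (Vec Step n) PositiveWalk0to1

data UBTree : Set where
  node0 : ℕ → UBTree
  node1 : ℕ → UBTree → UBTree
  node2 : ℕ → UBTree → UBTree → UBTree

label : UBTree → ℕ
label (node0 x)     = x
label (node1 x _)   = x
label (node2 x _ _) = x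

size : UBTree → ℕ
size (node0 _)     = 1
size (node1 _ t)   = suc (size t)
size (node2 _ t u) = suc (size t + size u)

labels : UBTree → List ℕ
labels (node0 x)     = x ∷ []
labels (node1 x t)   = x ∷ labels t
labels (node2 x t u) = x ∷ labels t ++ labels u

increasing : UBTree → Bool
increasing (node0 x)     = true
increasing (node1 x t)   = (x <ᵇ label t) ∧ increasing t
increasing (node2 x t u) = (x <ᵇ label t) ∧ (x <ᵇ label u) ∧ increasing t ∧ increasing u

-- the labels are a bijection onto {1,...,n} where n is the number of vertices
labelsAreOneToN : UBTree → Bool
labelsAreOneToN t =
  all (λ k → any (λ l → l ≡ᵇ k) (labels t)) (map suc (upTo (size t)))

IncreasingUBTree : ℕ → UBTree → Set
IncreasingUBTree n t = T ((size t ≡ᵇ n) ∧ labelsAreOneToN t ∧ increasing t)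

generation : ℕ → UBTree → List ℕ
generation zero    t             = label t ∷ []
generation (suc d) (node0 _)     = []
generation (suc d) (node1 _ t)   = generation d t
generation (suc d) (node2 _ t u) = generation d t ++ generation d u

-- breadth-first reading of labels (depths are < size t)
bfs : UBTree → List ℕ
bfs t = concatMap (λ d → generation d t) (upTo (size t))

has13After : ℕ → List ℕ → Bool
has13After x []       = false
has13After x (y ∷ ys) = ((y <ᵇ x) ∧ any (λ z → x <ᵇ z) ys) ∨ has13After x ys

avoids213 : List ℕ → Bool
avoids213 []       = true
avoids213 (x ∷ xs) = not (has13After x xs) ∧ avoids213 xs

Avoids213 : List ℕ → Set
Avoids213 σ = T (avoids213 σ)

IncTree213 : ℕ → Set
IncTree213 n = Σ UBTree (λ t → IncreasingUBTree n t × Avoids213 (bfs t))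

{-# OPTIONS --safe #-}
module Submission where

-- Let C be the Catalan series and G the power series with G + G² = C − 1. Walks from 0 to 1 and
-- increasing trees are both counted by G.
-- For walks, conditioning on the first step gives a linear system indexed by the starting height.
-- It is solved by a sequence satisfying a linear recurrence in the height with coefficients G and
-- G / (1 + G), the series of the walks from 1 whose first non-positive position is 0 and −1.
-- A tree is grown by adding its vertices in breadth-first order, the labels being shifted so that
-- they always fill an initial interval. If k is the last label, then avoidance of 213 means that
-- the next label v is at most k + 1, and that the labels 1, …, k occur in increasing order. Hence
-- the parent of the new vertex can be any label below v that is larger than the label p of the
-- previous parent, or p itself if it still has only one child. The continuations depend only on
-- a = k − p and on that last alternative, which gives a second linear system, indexed by a. Its
-- solution satisfies a recurrence of order three over the same ring of series.
-- Both systems determine their solutions coefficient by coefficient.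

open import Defs
open import Algebra.Bundles using (CommutativeRing)
import Algebra.Solver.Ring
open import Algebra.Solver.Ring.AlmostCommutativeRing
  using (fromCommutativeRing; _-Raw-AlmostCommutative⟶_; Induced-equivalence)
open import Data.Bool using (Bool; true; false; if_then_else_; T; not; _∧_)
open import Data.Bool.ListAction using (any)
open import Data.Bool.Properties using (T-∧; T-∨; T-irrelevant)
open import Data.Empty using (⊥)
open import Data.Fin using (Fin)
open import Data.Fin.Properties using (+↔⊎; 0↔⊥; 1↔⊤)
open import Data.Integer as ℤ using (ℤ; +_; 0ℤ; 1ℤ)
import Data.Integer.Properties as ℤₚ
open import Data.Integer.Tactic.RingSolver using (solve-∀)
open import Data.List using (List; []; _∷_; _++_; map; length; concatMap; applyUpTo; upTo; _∷ʳ_; initLast; _∷ʳ′_)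
open import Data.List.Membership.Propositional using (_∈_; _∉_; find; lose)
open import Data.List.Membership.Propositional.Properties
  using (∈-map⁺; ∈-map⁻; ∈-++⁺ˡ; ∈-++⁺ʳ; ∈-++⁻; ∈-∃++; ∈-upTo⁺; ∈-upTo⁻)
open import Data.List.Properties
  using (++-assoc; ++-identityʳ; map-++; length-++; length-map; concatMap-++; ∷ʳ-injective; ∷-injective; map-injective)
open import Data.List.Relation.Binary.Permutation.Propositional
  using (_↭_; ↭-refl; ↭-sym; ↭-trans; ↭-reflexive; prep; ↭⇒↭ₛ)
open import Data.List.Relation.Binary.Permutation.Propositional.Properties
  using (∈-resp-↭; All-resp-↭; ↭-length) renaming (shift to ↭-shift; ++-comm to ↭-++-comm)
import Data.List.Relation.Binary.Permutation.Setoid.Properties as Permutationₛ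
open import Data.List.Relation.Binary.Pointwise as Pointwise using (Pointwise; []; _∷_)
open import Data.List.Relation.Unary.All as All using (All; []; _∷_)
import Data.List.Relation.Unary.All.Properties as Allₚ
open import Data.List.Relation.Unary.AllPairs using ([]; _∷_)
open import Data.List.Relation.Unary.Any as Any using (Any; here; there)
import Data.List.Relation.Unary.Any.Properties as Anyₚ
open import Data.List.Relation.Unary.Unique.Propositional using (Unique)
import Data.List.Relation.Unary.Unique.Propositional.Properties as Uniqueₚ
open import Data.Maybe using (just; nothing)
open import Data.Nat as ℕ hiding (_^_)
open import Data.Nat.ListAction using (sum)
open import Data.Nat.ListAction.Properties using (sum-++)
open import Data.Nat.Properties as ℕₚ
open import Data.Product using (Σ; ∃; ∃₂; _×_; _,_; proj₁; proj₂)
open import Data.Sum using (_⊎_; inj₁; inj₂)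
open import Data.Sum.Function.Propositional using (_⊎-↔_)
open import Data.Unit using (⊤; tt)
open import Data.Vec using (Vec; []; _∷_)
open import Function using (_∘_; id; case_of_)
open import Function.Bundles using (_↔_; mk↔ₛ′; Equivalence)
open import Function.Properties.Inverse using (↔-sym; ↔-trans)
open import Level using (0ℓ)
open import Relation.Binary.Definitions using (WeaklyDecidable; tri<; tri≈; tri>)
open import Relation.Binary.PropositionalEquality
open import Relation.Nullary using (¬_; contradiction; yes; no)
open import Relation.Nullary.Decidable using (⌊_⌋)
open Equivalence using (to; from)

-- The two counting recurrences

sum< : ℕ → (ℕ → ℕ) → ℕ
sum< zero    f = 0
sum< (suc n) f = sum< n f + f n

-- Counts the walks from height `k` to 1 whose positions after the start are all positive, by their
-- first step.
walkCount : ℕ → ℕ → ℕ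
walkCount 1 zero = 1
walkCount _ zero = 0
walkCount 0 (suc n) = walkCount 1 n + walkCount 2 n
walkCount 1 (suc n) = walkCount 2 n + walkCount 3 n
walkCount 2 (suc n) = walkCount 1 n + walkCount 3 n + walkCount 4 n
walkCount (suc (suc (suc k))) (suc n) =
  walkCount (1 + k) n + walkCount (2 + k) n + walkCount (4 + k) n + walkCount (5 + k) n

-- The tree system: `a` is the last label minus the label of the previous parent, `b` tells whether
-- that parent has room for another child, and the last argument is the number of vertices still to
-- be added.
runCount : ℕ → Bool → ℕ → ℕ
runCount a b zero    = 1
runCount a b (suc m) = (sum< (suc a) λ e → sum< e λ c → runCount (suc c) true m)
                     + (if b then (sum< (suc a) λ i → runCount (suc i) false m) else 0)

-- Formal power series with integer coefficients

module PowerSeries where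

  Coefficients : Set
  Coefficients = ℕ → ℤ

  infixl 7 _⋆_

  _⋆_ : Coefficients → Coefficients → Coefficients
  (f ⋆ g) zero    = f 0 ℤ.* g 0
  (f ⋆ g) (suc n) = f 0 ℤ.* g (suc n) ℤ.+ (f ∘ suc ⋆ g) n

  ⋆-prefix : ∀ {f f′ g g′} n → (∀ {i} → i ℕ.≤ n → f i ≡ f′ i) → (∀ {i} → i ℕ.≤ n → g i ≡ g′ i) →
             (f ⋆ g) n ≡ (f′ ⋆ g′) n
  ⋆-prefix zero    p q = cong₂ ℤ._*_ (p ℕ.z≤n) (q ℕ.z≤n)
  ⋆-prefix (suc n) p q = cong₂ ℤ._+_ (cong₂ ℤ._*_ (p ℕ.z≤n) (q ℕₚ.≤-refl))
                                     (⋆-prefix n (p ∘ ℕ.s≤s) (q ∘ ℕₚ.m≤n⇒m≤1+n))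

  ⋆-distribʳ : ∀ h f g n → ((λ i → f i ℤ.+ g i) ⋆ h) n ≡ (f ⋆ h) n ℤ.+ (g ⋆ h) n
  ⋆-distribʳ h f g zero = ℤₚ.*-distribʳ-+ (h 0) (f 0) (g 0)
  ⋆-distribʳ h f g (suc n) rewrite ⋆-distribʳ h (f ∘ suc) (g ∘ suc) n =
    interchange (f 0) (g 0) (h (suc n)) _ _
    where
    interchange : ∀ a b c u v → (a ℤ.+ b) ℤ.* c ℤ.+ (u ℤ.+ v) ≡ (a ℤ.* c ℤ.+ u) ℤ.+ (b ℤ.* c ℤ.+ v)
    interchange = solve-∀

  ⋆-scale : ∀ a f g n → ((λ i → a ℤ.* f i) ⋆ g) n ≡ a ℤ.* (f ⋆ g) n
  ⋆-scale a f g zero = ℤₚ.*-assoc a (f 0) (g 0)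
  ⋆-scale a f g (suc n) rewrite ⋆-scale a (f ∘ suc) g n = factor a (f 0) (g (suc n)) _
    where
    factor : ∀ a b c u → a ℤ.* b ℤ.* c ℤ.+ a ℤ.* u ≡ a ℤ.* (b ℤ.* c ℤ.+ u)
    factor = solve-∀

  ⋆-assoc : ∀ f g h n → ((f ⋆ g) ⋆ h) n ≡ (f ⋆ (g ⋆ h)) n
  ⋆-assoc f g h zero = ℤₚ.*-assoc (f 0) (g 0) (h 0)
  ⋆-assoc f g h (suc n)
    rewrite ⋆-distribʳ h (λ i → f 0 ℤ.* g (suc i)) (f ∘ suc ⋆ g) n
          | ⋆-scale (f 0) (g ∘ suc) h n
          | ⋆-assoc (f ∘ suc) g h n = regroup (f 0) (g 0) (h (suc n)) _ _
    where
    regroup : ∀ a b c u v → a ℤ.* b ℤ.* c ℤ.+ (a ℤ.* u ℤ.+ v) ≡ a ℤ.* (b ℤ.* c ℤ.+ u) ℤ.+ v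
    regroup = solve-∀

  ⋆-sucʳ : ∀ f g n → (f ⋆ g) (suc n) ≡ (f ⋆ g ∘ suc) n ℤ.+ f (suc n) ℤ.* g 0
  ⋆-sucʳ f g zero = refl
  ⋆-sucʳ f g (suc n) rewrite ⋆-sucʳ (f ∘ suc) g n =
    sym (ℤₚ.+-assoc (f 0 ℤ.* g (suc (suc n))) _ _)

  ⋆-comm : ∀ f g n → (f ⋆ g) n ≡ (g ⋆ f) n
  ⋆-comm f g zero = ℤₚ.*-comm (f 0) (g 0)
  ⋆-comm f g (suc n) rewrite ⋆-sucʳ g f n | ⋆-comm (f ∘ suc) g n | ℤₚ.*-comm (f 0) (g (suc n)) =
    ℤₚ.+-comm _ ((g ⋆ f ∘ suc) n)

  ⋆-zeroˡ : ∀ f n → ((λ _ → 0ℤ) ⋆ f) n ≡ 0ℤ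
  ⋆-zeroˡ f zero    = refl
  ⋆-zeroˡ f (suc n) rewrite ⋆-zeroˡ f n = refl

  record Series : Set where
    no-eta-equality
    constructor series
    field coeff : Coefficients
  open Series public

  infix 4 _≋_
  record _≋_ (f g : Series) : Set where
    constructor pointwise
    field at : ∀ n → coeff f n ≡ coeff g n
  open _≋_ public

  constant : ℤ → Series
  coeff (constant a) zero    = a
  coeff (constant a) (suc n) = 0ℤ

  X : Series
  coeff X zero    = 0ℤ
  coeff X (suc n) = coeff (constant 1ℤ) n

  infixl 6 _⊕_
  infixl 7 _⊛_
  infix  8 ⊖_

  _⊕_ _⊛_ : Series → Series → Series
  coeff (f ⊕ g) n = coeff f n ℤ.+ coeff g n
  coeff (f ⊛ g) = coeff f ⋆ coeff g

  ⊖_ : Series → Series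
  coeff (⊖ f) n = ℤ.- coeff f n

  ⊛-comm : ∀ f g n → coeff (f ⊛ g) n ≡ coeff (g ⊛ f) n
  ⊛-comm f g = ⋆-comm (coeff f) (coeff g)

  ⊛-distribʳ : ∀ h f g n → coeff ((f ⊕ g) ⊛ h) n ≡ coeff (f ⊛ h) n ℤ.+ coeff (g ⊛ h) n
  ⊛-distribʳ h f g = ⋆-distribʳ (coeff h) (coeff f) (coeff g)

  ⊛-constantˡ : ∀ a f n → coeff (constant a ⊛ f) n ≡ a ℤ.* coeff f n
  ⊛-constantˡ a f zero = refl
  ⊛-constantˡ a f (suc n) rewrite ⋆-zeroˡ (coeff f) n = ℤₚ.+-identityʳ _

  X⊛-suc : ∀ f n → coeff (X ⊛ f) (suc n) ≡ coeff f n
  X⊛-suc f n rewrite ⊛-constantˡ 1ℤ f n = trans (ℤₚ.+-identityˡ _) (ℤₚ.*-identityˡ (coeff f n))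

  seriesRing : CommutativeRing 0ℓ 0ℓ
  seriesRing = record
    { Carrier = Series ; _≈_ = _≋_ ; _+_ = _⊕_ ; _*_ = _⊛_ ; -_ = ⊖_
    ; 0# = constant 0ℤ ; 1# = constant 1ℤ
    ; isCommutativeRing = record
      { isRing = record
        { +-isAbelianGroup = record
          { isGroup = record
            { isMonoid = record
              { isSemigroup = record
                { isMagma = record
                  { isEquivalence = record
                    { refl = pointwise λ _ → refl
                    ; sym = λ p → pointwise λ n → sym (at p n)
                    ; trans = λ p q → pointwise λ n → trans (at p n) (at q n) }
                  ; ∙-cong = λ p q → pointwise λ n → cong₂ ℤ._+_ (at p n) (at q n) }
                ; assoc = λ f g h → pointwise λ n → ℤₚ.+-assoc (coeff f n) (coeff g n) (coeff h n) }
              ; identity = (λ f → pointwise λ n → trans (cong (ℤ._+ coeff f n) (zeros n)) (ℤₚ.+-identityˡ (coeff f n)))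
                         , (λ f → pointwise λ n → trans (cong (ℤ._+_ (coeff f n)) (zeros n)) (ℤₚ.+-identityʳ (coeff f n))) }
            ; inverse = (λ f → pointwise λ n → trans (ℤₚ.+-inverseˡ (coeff f n)) (sym (zeros n)))
                      , (λ f → pointwise λ n → trans (ℤₚ.+-inverseʳ (coeff f n)) (sym (zeros n)))
            ; ⁻¹-cong = λ p → pointwise λ n → cong ℤ.-_ (at p n) }
          ; comm = λ f g → pointwise λ n → ℤₚ.+-comm (coeff f n) (coeff g n) }
        ; *-cong = λ p q → pointwise λ n → ⋆-prefix n (λ {i} _ → at p i) (λ {i} _ → at q i)
        ; *-assoc = λ f g h → pointwise (⋆-assoc (coeff f) (coeff g) (coeff h))
        ; *-identity = (λ f → pointwise λ n → unitˡ f n)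
                     , (λ f → pointwise λ n → trans (⊛-comm f (constant 1ℤ) n) (unitˡ f n))
        ; distrib = (λ f g h → pointwise λ n → trans (⊛-comm f (g ⊕ h) n)
                       (trans (⊛-distribʳ f g h n) (cong₂ ℤ._+_ (⊛-comm g f n) (⊛-comm h f n))))
                  , (λ h f g → pointwise (⊛-distribʳ h f g)) }
      ; *-comm = λ f g → pointwise (⊛-comm f g) } }
    where
    zeros : ∀ n → coeff (constant 0ℤ) n ≡ 0ℤ
    zeros zero    = refl
    zeros (suc n) = refl
    unitˡ : ∀ f n → coeff (constant 1ℤ ⊛ f) n ≡ coeff f n
    unitˡ f n = trans (⊛-constantˡ 1ℤ f n) (ℤₚ.*-identityˡ (coeff f n))

  integerRing = CommutativeRing.rawRing ℤₚ.+-*-commutativeRing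
  seriesAlmostRing = fromCommutativeRing seriesRing

  constants : integerRing -Raw-AlmostCommutative⟶ seriesAlmostRing
  constants = record
    { ⟦_⟧ = constant
    ; +-homo = λ a b → pointwise λ { zero → refl ; (suc n) → refl }
    ; *-homo = λ a b → pointwise λ { zero → refl ; (suc n) → sym (trans (⊛-constantˡ a (constant b) (suc n)) (ℤₚ.*-zeroʳ a)) }
    ; -‿homo = λ a → pointwise λ { zero → refl ; (suc n) → refl }
    ; 0-homo = pointwise λ _ → refl
    ; 1-homo = pointwise λ _ → refl }

  constant≟ : WeaklyDecidable (Induced-equivalence constants)
  constant≟ a b = case a ℤₚ.≟ b of λ { (yes refl) → just (pointwise λ _ → refl) ; (no _) → nothing }

  module Solver = Algebra.Solver.Ring integerRing seriesAlmostRing constants constant≟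

  module R = CommutativeRing seriesRing

  -- Coefficient `n` of `Φ f` depends only on the coefficients of `f` below `n`, so all
  -- approximations from the one with index `n + 1` on agree at `n`. The limit is read off along
  -- this diagonal.
  module Fixpoint (Φ : Series → Series)
    (contractive : ∀ {f g} n → (∀ {i} → i ℕ.< n → coeff f i ≡ coeff g i) → coeff (Φ f) n ≡ coeff (Φ g) n) where

    approximation : ℕ → Series
    approximation zero    = constant 0ℤ
    approximation (suc m) = Φ (approximation m)

    fixpoint : Series
    coeff fixpoint n = coeff (approximation (suc n)) n

    approximation-stable : ∀ {m m′} n → n ℕ.< m → n ℕ.< m′ → coeff (approximation m) n ≡ coeff (approximation m′) n
    approximation-stable n (ℕ.s≤s p) (ℕ.s≤s q) = contractive n λ {i} i<n →
      approximation-stable i (ℕₚ.<-≤-trans i<n p) (ℕₚ.<-≤-trans i<n q)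

    fixpoint-unfold : fixpoint ≋ Φ fixpoint
    fixpoint-unfold = pointwise λ n → contractive n λ {i} i<n →
      approximation-stable i i<n ℕₚ.≤-refl

  -- The factor `X` makes the right-hand side contractive. This shape of equation covers the Catalan
  -- series, the quotient of `G` by `X`, and the inverse of `1 + G`.
  quadratic-fixpoint : ∀ k a b → ∃ λ f → f ≋ k ⊕ X ⊛ (a ⊛ (f ⊛ f) ⊕ b ⊛ f)
  quadratic-fixpoint k a b = Fixpoint.fixpoint Φ (λ {f} {g} → contractive {f} {g}) , Fixpoint.fixpoint-unfold Φ (λ {f} {g} → contractive {f} {g})
    where
    Φ : Series → Series
    Φ f = k ⊕ X ⊛ (a ⊛ (f ⊛ f) ⊕ b ⊛ f)
    contractive : ∀ {f g} n → (∀ {i} → i ℕ.< n → coeff f i ≡ coeff g i) → coeff (Φ f) n ≡ coeff (Φ g) n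
    contractive zero p = refl
    contractive {f} {g} (suc n) p = cong (ℤ._+_ (coeff k (suc n)))
      (trans (X⊛-suc (a ⊛ (f ⊛ f) ⊕ b ⊛ f) n) (trans
        (cong₂ ℤ._+_ (⋆-prefix {coeff a} n (λ _ → refl) (λ {i} i≤n → ⋆-prefix i (q i≤n) (q i≤n)))
                     (⋆-prefix {coeff b} n (λ _ → refl) (λ i≤n → p (ℕ.s≤s i≤n))))
        (sym (X⊛-suc (a ⊛ (g ⊛ g) ⊕ b ⊛ g) n))))
      where
      q : ∀ {i j} → i ℕ.≤ n → j ℕ.≤ i → coeff f j ≡ coeff g j
      q i≤n j≤i = p (ℕ.s≤s (ℕₚ.≤-trans j≤i i≤n))

  open import Algebra.Properties.Semiring.Exp R.semiring using (_^_)
  open Solver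

  𝟘 𝟙 : Series
  𝟘 = constant 0ℤ
  𝟙 = constant 1ℤ

  -- Reduces an identity modulo a relation `z ≋ 𝟘` to a plain ring identity with an explicit
  -- cofactor `p`, which the solver can check. Nested uses handle several relations.
  modulo : ∀ {f g p z} → z ≋ 𝟘 → f ≋ g ⊕ p ⊛ z → f ≋ g
  modulo {f} {g} {p} {z} z≋𝟘 f≋ = begin
    f          ≈⟨ f≋ ⟩
    g ⊕ p ⊛ z  ≈⟨ R.+-cong R.refl (R.*-cong R.refl z≋𝟘) ⟩
    g ⊕ p ⊛ 𝟘  ≈⟨ R.+-cong R.refl (R.zeroʳ p) ⟩
    g ⊕ 𝟘      ≈⟨ R.+-identityʳ g ⟩
    g          ∎
    where open import Relation.Binary.Reasoning.Setoid R.setoid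

  vanish : ∀ {f g} → f ≋ g → f ⊕ ⊖ g ≋ 𝟘
  vanish {f} {g} f≋g = R.trans (R.+-cong f≋g R.refl) (R.-‿inverseʳ g)

  -- The Catalan series, G, and the inverses of 1 + G and C

  catalan : ∃ λ f → f ≋ 𝟙 ⊕ X ⊛ (𝟙 ⊛ (f ⊛ f) ⊕ 𝟘 ⊛ f)
  catalan = quadratic-fixpoint 𝟙 𝟙 𝟘

  module _ where
    private
      D = proj₁ catalan
      -- G = X H turns G + G² = D − 1 into an equation for H whose recursion is guarded by X.
      half : ∃ λ h → h ≋ D ⊛ D ⊕ X ⊛ (⊖ 𝟙 ⊛ (h ⊛ h) ⊕ 𝟘 ⊛ h)
      half = quadratic-fixpoint (D ⊛ D) (⊖ 𝟙) 𝟘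
      H = proj₁ half

    G : Series
    G = X ⊛ H

    q C : Series
    q = 𝟙 ⊕ G
    C = 𝟙 ⊕ G ⊕ G ⊛ G

    private
      inverse : ∃ λ r → r ≋ 𝟙 ⊕ X ⊛ (𝟘 ⊛ (r ⊛ r) ⊕ ⊖ H ⊛ r)
      inverse = quadratic-fixpoint 𝟙 𝟘 (⊖ H)

    r c : Series
    r = proj₁ inverse
    c = 𝟙 ⊕ ⊖ (X ⊛ D)

    -- The equation defining `r` is `r = 1 − X H r`, that is `r + G r = 1`.
    qr≋𝟙 : q ⊛ r ≋ 𝟙
    qr≋𝟙 = modulo (vanish (proj₂ inverse))
      (solve 3 (λ x h r → (con 1ℤ :+ x :* h) :* r :=
        con 1ℤ :+ con 1ℤ :* (r :+ :- (con 1ℤ :+ x :* (con 0ℤ :* (r :* r) :+ :- h :* r)))) R.refl X H r)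

    private
      -- Multiplying `H = D² − X H²` by `X` gives `G + G² = X D²`, which is `D − 1`.
      D≋C : D ≋ C
      D≋C = modulo (vanish (proj₂ catalan)) (modulo (vanish (proj₂ half))
        (solve 3 (λ x d h → d := (con 1ℤ :+ x :* h :+ x :* h :* (x :* h))
           :+ con 1ℤ :* (d :+ :- (con 1ℤ :+ x :* (con 1ℤ :* (d :* d) :+ con 0ℤ :* d)))
           :+ :- x :* (h :+ :- (d :* d :+ x :* (:- con 1ℤ :* (h :* h) :+ con 0ℤ :* h)))) R.refl X D H))

    Cc≋𝟙 : C ⊛ c ≋ 𝟙
    Cc≋𝟙 = R.trans (R.*-cong (R.sym D≋C) R.refl) (modulo (vanish (proj₂ catalan))
        (solve 2 (λ x d → d :* (con 1ℤ :+ :- (x :* d)) := con 1ℤ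
           :+ con 1ℤ :* (d :+ :- (con 1ℤ :+ x :* (con 1ℤ :* (d :* d) :+ con 0ℤ :* d)))) R.refl X D))

    -- Since `G q = G + G² = D − 1 = X D²` and `c` is the inverse of `D`, multiplication by `c²`
    -- isolates `X`.
    X≋Gqcc : X ≋ G ⊛ q ⊛ c ⊛ c
    X≋Gqcc = modulo (vanish D≋C) (modulo (vanish (proj₂ catalan)) (modulo (vanish Dc≋𝟙)
        (solve 4 (λ x d g c → x := g :* (con 1ℤ :+ g) :* c :* c
           :+ c :* c :* (d :+ :- (con 1ℤ :+ g :+ g :* g))
           :+ :- (c :* c) :* (d :+ :- (con 1ℤ :+ x :* (con 1ℤ :* (d :* d) :+ con 0ℤ :* d)))
           :+ :- (x :* (d :* c :+ con 1ℤ)) :* (d :* c :+ :- con 1ℤ)) R.refl X D G c)))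
      where
      Dc≋𝟙 : D ⊛ c ≋ 𝟙
      Dc≋𝟙 = R.trans (R.*-cong D≋C R.refl) Cc≋𝟙

  -- Polynomial identities in G, r and c

  unit : ∀ i j → (q ⊛ r) ^ i ⊛ (C ⊛ c) ^ j ⊕ ⊖ 𝟙 ≋ 𝟘
  unit i j = vanish (R.trans (R.*-cong (power i qr≋𝟙) (power j Cc≋𝟙)) (R.*-identityˡ 𝟙))
    where
    power : ∀ {f} i → f ≋ 𝟙 → f ^ i ≋ 𝟙
    power zero    f≋𝟙 = R.refl
    power (suc i) f≋𝟙 = R.trans (R.*-cong f≋𝟙 (power i f≋𝟙)) (R.*-identityˡ 𝟙)

  -- Replacing X by this expression turns all identities below into polynomial ones in G, r and c,
  -- modulo q r = 1 and C c = 1.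
  X′ : Series
  X′ = G ⊛ q ⊛ c ⊛ c

  -- Solver expressions for the series defined below, in the variables `g`, `r` and `c`, so that the
  -- solver sees through `α`, `κ`, `W₂` and the others.
  module Polynomials {n : ℕ} where
    𝟏 : Polynomial n
    𝟏 = con 1ℤ
    qₚ Cₚ : Polynomial n → Polynomial n
    qₚ g = 𝟏 :+ g
    Cₚ g = 𝟏 :+ g :+ g :* g
    Xₚ : (g c : Polynomial n) → Polynomial n
    Xₚ g c = g :* qₚ g :* c :* c
    unitₚ : (g r c : Polynomial n) (i j : ℕ) → Polynomial n
    unitₚ g r c i j = (qₚ g :* r) :^ i :* (Cₚ g :* c) :^ j :+ :- 𝟏
    αₚ βₚ γₚ : (g r : Polynomial n) → Polynomial n
    αₚ g r = (Cₚ g :* Cₚ g :* qₚ g :+ :- (qₚ g :* qₚ g)) :* (r :* r)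
    βₚ g r = Cₚ g :* Cₚ g :* Cₚ g :* (r :* r)
    γₚ g r = g :* g :* qₚ g :* (r :* r)
    κₚ : (g r c : Polynomial n) → Polynomial n
    κₚ g r c = Xₚ g c :+ Xₚ g c :* Xₚ g c :* (𝟏 :+ 𝟏 :+ αₚ g r :+ βₚ g r :+ γₚ g r)
    Vₚ W₂ₚ W₃ₚ W₄ₚ xₚ : (g r : Polynomial n) → Polynomial n
    Vₚ g r = g :* r
    W₂ₚ g r = g :* g :+ Vₚ g r :* 𝟏
    W₃ₚ g r = g :* W₂ₚ g r :+ Vₚ g r :* g
    W₄ₚ g r = g :* W₃ₚ g r :+ Vₚ g r :* W₂ₚ g r
    xₚ g r = Cₚ g :* Cₚ g :* (r :* r)
  open Polynomials

  -- α, β and γ are read off the characteristic polynomial (E − C r²) (E² − (1 + C) C E + C²) of the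
  -- recurrence solving the tree system; V and the Wᵢ belong to the walk system, and x counts the
  -- positive walks from 1 to 1.
  α β γ κ V W₂ W₃ W₄ x : Series
  α = (C ⊛ C ⊛ q ⊕ ⊖ (q ⊛ q)) ⊛ (r ⊛ r)
  β = C ⊛ C ⊛ C ⊛ (r ⊛ r)
  γ = G ⊛ G ⊛ q ⊛ (r ⊛ r)
  κ = X′ ⊕ X′ ⊛ X′ ⊛ (𝟙 ⊕ 𝟙 ⊕ α ⊕ β ⊕ γ)
  V = G ⊛ r
  W₂ = G ⊛ G ⊕ V ⊛ 𝟙
  W₃ = G ⊛ W₂ ⊕ V ⊛ G
  W₄ = G ⊛ W₃ ⊕ V ⊛ W₂
  x = C ⊛ C ⊛ (r ⊛ r)

  -- Here and below, the multiples of unitₚ g r c i j are multiples of (q r)ⁱ (C c)ʲ − 1 = 0.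
  κ-eq : κ ⊕ q ⊛ q ⊛ c ⊛ c ⊛ c ≋ 𝟙
  κ-eq = modulo (unit 0 3) (modulo (unit 0 1) (modulo (unit 2 1) (modulo (unit 2 0)
    (solve 3 (λ g r c → κₚ g r c :+ qₚ g :* qₚ g :* c :* c :* c := 𝟏
      :+ 𝟏 :* unitₚ g r c 0 3
      :+ :- (g :* qₚ g :* c :* c) :* unitₚ g r c 0 1
      :+ g :* g :* (Cₚ g :* qₚ g :* qₚ g :+ qₚ g :* qₚ g :+ 𝟏) :* c :* c :* c :* unitₚ g r c 2 1
      :+ :- (con (+ 2) :* (Xₚ g c :* Xₚ g c)) :* unitₚ g r c 2 0) R.refl G r c))))

  -- Write the tree system at `a` with `treeTail (a + 2)` unfolded through the recurrence. Then
  -- `freshStep (a + 1)` reappears on the right with coefficient `κ`, and comparing the coefficients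
  -- of `freshStep a`, `treeTail a` and `freshSeries a` gives `β-eq`, `γ-eq` and `α-eq`. By `κ-eq`,
  -- `1 − κ` is the inverse of `C³ r²`, the value of `β`.
  β-eq : β ≋ 𝟙 ⊕ κ ⊛ β
  β-eq = modulo (unit 2 3) (modulo (vanish κ-eq)
    (solve 3 (λ g r c → βₚ g r := 𝟏 :+ κₚ g r c :* βₚ g r
      :+ 𝟏 :* unitₚ g r c 2 3
      :+ :- βₚ g r :* (κₚ g r c :+ qₚ g :* qₚ g :* c :* c :* c :+ :- 𝟏)) R.refl G r c))

  γ-eq : γ ≋ X′ ⊛ X′ ⊛ (𝟙 ⊕ γ) ⊕ κ ⊛ γ
  γ-eq = modulo (unit 2 1) (modulo (unit 2 0) (modulo (vanish κ-eq)
    (solve 3 (λ g r c → γₚ g r := Xₚ g c :* Xₚ g c :* (𝟏 :+ γₚ g r) :+ κₚ g r c :* γₚ g r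
      :+ :- (g :* g :* qₚ g :* c :* c :* c) :* unitₚ g r c 2 1
      :+ (Xₚ g c :* Xₚ g c :+ g :* g :* qₚ g :* c :* c :* c) :* unitₚ g r c 2 0
      :+ :- γₚ g r :* (κₚ g r c :+ qₚ g :* qₚ g :* c :* c :* c :+ :- 𝟏)) R.refl G r c)))

  α-eq : α ≋ X′ ⊕ X′ ⊛ X′ ⊛ (𝟙 ⊕ 𝟙 ⊕ α ⊕ γ) ⊕ κ ⊛ α
  α-eq = modulo (unit 0 1) (modulo (unit 2 0) (modulo (vanish κ-eq)
    (solve 3 (λ g r c → αₚ g r := Xₚ g c :+ Xₚ g c :* Xₚ g c :* (𝟏 :+ 𝟏 :+ αₚ g r :+ γₚ g r) :+ κₚ g r c :* αₚ g r
      :+ qₚ g :* c :* c :* (Cₚ g :+ :- (g :* g :* (Cₚ g :* c :+ 𝟏)) :+ :- (g :* g :* c) :+ :- 𝟏) :* unitₚ g r c 0 1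
      :+ (con (+ 2) :* (Xₚ g c :* Xₚ g c) :+ (Cₚ g :* Cₚ g :* qₚ g :+ :- (qₚ g :* qₚ g)) :* c :* c :* c
          :+ :- (g :* g :* qₚ g :* c :* c :* c :* c :* (Cₚ g :* Cₚ g :+ Cₚ g))) :* unitₚ g r c 2 0
      :+ :- αₚ g r :* (κₚ g r c :+ qₚ g :* qₚ g :* c :* c :* c :+ :- 𝟏)) R.refl G r c)))

  -- `𝟙 ⊕ α` equals `freshSeries 1`, the series of the continuations of the one-vertex tree; the
  -- factor `X` stands for the root.
  first-tree : G ≋ X′ ⊛ (𝟙 ⊕ α)
  first-tree = modulo (unit 2 0) (modulo (unit 2 2)
    (solve 3 (λ g r c → g := Xₚ g c :* (𝟏 :+ αₚ g r)
       :+ Xₚ g c :* unitₚ g r c 2 0 :+ :- g :* unitₚ g r c 2 2) R.refl G r c))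

  -- First-step equation for the walks whose first non-positive position is 0, started at 1 here and
  -- at 2 in `W₂-eq`. From 1, a step of -2 lands on -1 and contributes nothing.
  W₁-eq : G ≋ X′ ⊛ (𝟙 ⊕ W₂ ⊕ W₃)
  W₁-eq = modulo (unit 0 2) (modulo (unit 1 0)
    (solve 3 (λ g r c → g := Xₚ g c :* (𝟏 :+ W₂ₚ g r :+ W₃ₚ g r)
       :+ :- g :* unitₚ g r c 0 2 :+ :- (g :* c :* c :* (g :+ con (+ 2) :* g :* g)) :* unitₚ g r c 1 0) R.refl G r c))

  W₂-eq : W₂ ≋ X′ ⊛ (𝟙 ⊕ G ⊕ W₃ ⊕ W₄)
  W₂-eq = modulo (unit 0 2) (modulo (unit 1 0)
    (solve 3 (λ g r c → W₂ₚ g r := Xₚ g c :* (𝟏 :+ g :+ W₃ₚ g r :+ W₄ₚ g r)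
       :+ :- (g :* Cₚ g :* r) :* unitₚ g r c 0 2
       :+ (:- (g :* g) :+ Xₚ g c :* (𝟏 :+ g :+ g :^ 3 :+ g :^ 4) :+ :- (g :^ 3 :* c :* c :* r)) :* unitₚ g r c 1 0) R.refl G r c))

  x-eq : x ≋ 𝟙 ⊕ X′ ⊛ (G ⊛ x ⊕ W₂ ⊛ x)
  x-eq = modulo (unit 1 2) (modulo (unit 2 2) (modulo (unit 2 0)
    (solve 3 (λ g r c → xₚ g r := 𝟏 :+ Xₚ g c :* (g :* xₚ g r :+ W₂ₚ g r :* xₚ g r)
       :+ :- (g :* g :* r :* r) :* unitₚ g r c 1 2
       :+ :- (g :* g) :* unitₚ g r c 2 2
       :+ (𝟏 :+ g :* g) :* unitₚ g r c 2 0) R.refl G r c)))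

  x₀-eq : G ≋ X′ ⊛ (x ⊕ G ⊛ x)
  x₀-eq = modulo (unit 2 2)
    (solve 3 (λ g r c → g := Xₚ g c :* (xₚ g r :+ g :* xₚ g r) :+ :- g :* unitₚ g r c 2 2) R.refl G r c)

  -- Solutions of the walk system and of the tree system

  X⊛≋X′⊛ : ∀ f → X ⊛ f ≋ X′ ⊛ f
  X⊛≋X′⊛ f = R.*-cong X≋Gqcc R.refl

  -- The series of the walks from `k` whose first non-positive position is 0. From `k + 2`, the
  -- first position below the start is `k + 1` or `k`, with series `G` and `V` respectively.
  descent : ℕ → Series
  descent 0 = 𝟙
  descent 1 = G
  descent (suc (suc k)) = G ⊛ descent (suc k) ⊕ V ⊛ descent k

  -- The first-step equation is linear, so it propagates along the recurrence: `G` times one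
  -- instance plus `V` times the preceding one gives the next. For `descent 3` the preceding
  -- instance is `W₁-eq`, whose missing term would be the zero series of the start -1.
  descent-eq : ∀ k → descent (2 + k) ≋ X′ ⊛ (descent k ⊕ descent (1 + k) ⊕ descent (3 + k) ⊕ descent (4 + k))
  descent-eq 0 = W₂-eq
  descent-eq 1 = modulo (vanish W₁-eq) (modulo (vanish W₂-eq)
    (solve 3 (λ t g v → let w₂ = g :* g :+ v :* 𝟏 ; w₃ = g :* w₂ :+ v :* g ; w₄ = g :* w₃ :+ v :* w₂ in
        w₃ := t :* (g :+ w₂ :+ w₄ :+ (g :* w₄ :+ v :* w₃))
          :+ v :* (g :+ :- (t :* (𝟏 :+ w₂ :+ w₃)))
          :+ g :* (w₂ :+ :- (t :* (𝟏 :+ g :+ w₃ :+ w₄)))) R.refl X′ G V))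
  descent-eq (suc (suc k)) = R.trans (R.+-cong (R.*-cong R.refl (descent-eq (suc k))) (R.*-cong R.refl (descent-eq k)))
    (solve 9 (λ t g v w₁ w₂ w₃ w₄ w₅ w₆ →
        g :* (t :* (w₂ :+ w₃ :+ w₅ :+ w₆)) :+ v :* (t :* (w₁ :+ w₂ :+ w₄ :+ w₅)) :=
        t :* ((g :* w₂ :+ v :* w₁) :+ (g :* w₃ :+ v :* w₂) :+ (g :* w₅ :+ v :* w₄) :+ (g :* w₆ :+ v :* w₅)))
      R.refl X′ G V (descent k) (descent (1 + k)) (descent (2 + k)) (descent (3 + k)) (descent (4 + k)) (descent (5 + k)))

  -- A positive walk from a height of at least 2 to 1 is cut where it first reaches 1: a descent,
  -- then a positive walk from 1 to 1. For the start 0, reversal gives the walks from 1 whose first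
  -- non-positive position is 0, hence `G`.
  walkSeries : ℕ → Series
  walkSeries 0 = G
  walkSeries 1 = x
  walkSeries (suc (suc k)) = descent (suc k) ⊛ x

  walkSeries-0 : walkSeries 0 ≋ X ⊛ (walkSeries 1 ⊕ walkSeries 2)
  walkSeries-0 = R.trans x₀-eq (R.sym (X⊛≋X′⊛ _))

  walkSeries-1 : walkSeries 1 ≋ 𝟙 ⊕ X ⊛ (walkSeries 2 ⊕ walkSeries 3)
  walkSeries-1 = R.trans x-eq (R.+-cong R.refl (R.sym (X⊛≋X′⊛ _)))

  walkSeries-2 : walkSeries 2 ≋ X ⊛ (walkSeries 1 ⊕ walkSeries 3 ⊕ walkSeries 4)
  walkSeries-2 = R.trans (R.*-cong W₁-eq R.refl) (R.trans
    (solve 4 (λ t y w₂ w₃ → t :* (𝟏 :+ w₂ :+ w₃) :* y := t :* (y :+ w₂ :* y :+ w₃ :* y)) R.refl X′ x W₂ W₃)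
    (R.sym (X⊛≋X′⊛ _)))

  walkSeries-3+ : ∀ k → walkSeries (3 + k) ≋
    X ⊛ (walkSeries (1 + k) ⊕ walkSeries (2 + k) ⊕ walkSeries (4 + k) ⊕ walkSeries (5 + k))
  walkSeries-3+ k = R.trans (R.*-cong (descent-eq k) R.refl) (R.trans (lower k) (R.sym (X⊛≋X′⊛ _)))
    where
    lower : ∀ k → X′ ⊛ (descent k ⊕ descent (1 + k) ⊕ descent (3 + k) ⊕ descent (4 + k)) ⊛ x ≋
      X′ ⊛ (walkSeries (1 + k) ⊕ walkSeries (2 + k) ⊕ walkSeries (4 + k) ⊕ walkSeries (5 + k))
    lower zero = solve 5 (λ t y w₁ w₃ w₄ → t :* (𝟏 :+ w₁ :+ w₃ :+ w₄) :* y :=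
      t :* (y :+ w₁ :* y :+ w₃ :* y :+ w₄ :* y)) R.refl X′ x G W₃ W₄
    lower (suc k) = solve 6 (λ t y w₀ w₁ w₃ w₄ → t :* (w₀ :+ w₁ :+ w₃ :+ w₄) :* y :=
      t :* (w₀ :* y :+ w₁ :* y :+ w₃ :* y :+ w₄ :* y)) R.refl
      X′ x (descent (suc k)) (descent (2 + k)) (descent (4 + k)) (descent (5 + k))

  walkSeries-coeff : ∀ n k → coeff (walkSeries k) n ≡ + walkCount k n
  walkSeries-coeff zero 0 = at walkSeries-0 0
  walkSeries-coeff zero 1 = at walkSeries-1 0
  walkSeries-coeff zero 2 = at walkSeries-2 0
  walkSeries-coeff zero (suc (suc (suc k))) = at (walkSeries-3+ k) 0
  walkSeries-coeff (suc n) 0 = trans (at walkSeries-0 (suc n))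
    (trans (X⊛-suc (walkSeries 1 ⊕ walkSeries 2) n) (cong₂ ℤ._+_ (walkSeries-coeff n 1) (walkSeries-coeff n 2)))
  walkSeries-coeff (suc n) 1 = trans (at walkSeries-1 (suc n)) (trans (ℤₚ.+-identityˡ _)
    (trans (X⊛-suc (walkSeries 2 ⊕ walkSeries 3) n) (cong₂ ℤ._+_ (walkSeries-coeff n 2) (walkSeries-coeff n 3))))
  walkSeries-coeff (suc n) 2 = trans (at walkSeries-2 (suc n))
    (trans (X⊛-suc (walkSeries 1 ⊕ walkSeries 3 ⊕ walkSeries 4) n)
      (cong₂ ℤ._+_ (cong₂ ℤ._+_ (walkSeries-coeff n 1) (walkSeries-coeff n 3)) (walkSeries-coeff n 4)))
  walkSeries-coeff (suc n) (suc (suc (suc k))) = trans (at (walkSeries-3+ k) (suc n))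
    (trans (X⊛-suc (walkSeries (1 + k) ⊕ walkSeries (2 + k) ⊕ walkSeries (4 + k) ⊕ walkSeries (5 + k)) n)
      (cong₂ ℤ._+_ (cong₂ ℤ._+_ (cong₂ ℤ._+_ (walkSeries-coeff n (1 + k)) (walkSeries-coeff n (2 + k)))
        (walkSeries-coeff n (4 + k))) (walkSeries-coeff n (5 + k))))

  -- The system to solve is freshStep (a + 1) = freshStep a + X runSeries (a + 1) true, which involves
  -- treeTail (a + 2); a recurrence that only goes upwards in a is imposed instead.
  mutual
    freshSeries freshStep treeTail : ℕ → Series
    freshSeries zero    = 𝟙
    freshSeries (suc a) = freshSeries a ⊕ freshStep (suc a)
    freshStep zero    = 𝟘
    freshStep (suc a) = α ⊛ freshSeries a ⊕ β ⊛ freshStep a ⊕ γ ⊛ treeTail a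
    treeTail zero    = 𝟘
    treeTail (suc a) = treeTail a ⊕ freshSeries (suc a)

  -- With the flag set, the next vertex may also become the second child of the previous parent, for
  -- each `i ≤ a`; these choices add up to `X ⊛ treeTail (suc a)`.
  runSeries : ℕ → Bool → Series
  runSeries a false = freshSeries a
  runSeries a true  = freshSeries a ⊕ X ⊛ treeTail (suc a)

  -- This is the system itself, recovered from the imposed recurrence: after unfolding, both sides
  -- are linear in `freshSeries a`, `freshStep a` and `treeTail a`, and the coefficients agree by
  -- `α-eq`, `β-eq` and `γ-eq`.
  freshStep-eq : ∀ a → freshStep (suc a) ≋ freshStep a ⊕ X ⊛ runSeries (suc a) true
  freshStep-eq a = R.trans equation (R.+-cong R.refl
      (R.trans (R.sym (X⊛≋X′⊛ _)) (R.*-cong R.refl (R.+-cong R.refl (R.sym (X⊛≋X′⊛ _))))))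
    where
    equation : freshStep (suc a) ≋ freshStep a ⊕ X′ ⊛ (freshSeries (suc a) ⊕ X′ ⊛ treeTail (suc (suc a)))
    equation = modulo (vanish γ-eq) (modulo (vanish β-eq) (modulo (vanish α-eq)
      (solve 7 (λ t α β γ A d s →
         let k  = t :+ t :* t :* (𝟏 :+ 𝟏 :+ α :+ β :+ γ)
             d₁ = α :* A :+ β :* d :+ γ :* s ; A₁ = A :+ d₁ ; s₁ = s :+ A₁
             d₂ = α :* A₁ :+ β :* d₁ :+ γ :* s₁ ; A₂ = A₁ :+ d₂ ; s₂ = s₁ :+ A₂
         in d₁ := d :+ t :* (A₁ :+ t :* s₂)
              :+ s :* (γ :+ :- (t :* t :* (𝟏 :+ γ) :+ k :* γ))
              :+ d :* (β :+ :- (𝟏 :+ k :* β))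
              :+ A :* (α :+ :- (t :+ t :* t :* (𝟏 :+ 𝟏 :+ α :+ γ) :+ k :* α)))
        R.refl X′ α β γ (freshSeries a) (freshStep a) (treeTail a))))

  freshStep-zero : ∀ a → coeff (freshStep a) 0 ≡ 0ℤ
  freshStep-zero zero    = refl
  freshStep-zero (suc a) = trans (at (freshStep-eq a) 0) (trans (ℤₚ.+-identityʳ _) (freshStep-zero a))

  freshSeries-zero : ∀ a → coeff (freshSeries a) 0 ≡ 1ℤ
  freshSeries-zero zero    = refl
  freshSeries-zero (suc a) = cong₂ ℤ._+_ (freshSeries-zero a) (freshStep-zero (suc a))

  -- The induction step on the coefficient index. Successive differences telescope: `freshStep` into
  -- the inner sum of `runCount`, then `freshSeries` into the double sum.
  module _ (m : ℕ) (ih : ∀ a b → coeff (runSeries a b) m ≡ + runCount a b m) where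

    freshStep-coeff : ∀ a → coeff (freshStep a) (suc m) ≡ + sum< a λ c → runCount (suc c) true m
    freshStep-coeff zero    = refl
    freshStep-coeff (suc a) = trans (at (freshStep-eq a) (suc m))
      (cong₂ ℤ._+_ (freshStep-coeff a) (trans (X⊛-suc (runSeries (suc a) true) m) (ih (suc a) true)))

    freshSeries-coeff : ∀ a → coeff (freshSeries a) (suc m) ≡ + sum< (suc a) λ e → sum< e λ c → runCount (suc c) true m
    freshSeries-coeff zero    = refl
    freshSeries-coeff (suc a) = cong₂ ℤ._+_ (freshSeries-coeff a) (freshStep-coeff (suc a))

    treeTail-coeff : ∀ a → coeff (treeTail a) m ≡ + sum< a λ i → runCount (suc i) false m
    treeTail-coeff zero    = zeros m
      where
      zeros : ∀ m → coeff 𝟘 m ≡ 0ℤ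
      zeros zero    = refl
      zeros (suc m) = refl
    treeTail-coeff (suc a) = cong₂ ℤ._+_ (treeTail-coeff a) (ih (suc a) false)

  runSeries-coeff : ∀ m a b → coeff (runSeries a b) m ≡ + runCount a b m
  runSeries-coeff zero a false = freshSeries-zero a
  runSeries-coeff zero a true  = trans (ℤₚ.+-identityʳ _) (freshSeries-zero a)
  runSeries-coeff (suc m) a false = trans (freshSeries-coeff m (runSeries-coeff m) a) (sym (ℤₚ.+-identityʳ _))
  runSeries-coeff (suc m) a true  = cong₂ ℤ._+_ (freshSeries-coeff m (runSeries-coeff m) a)
    (trans (X⊛-suc (treeTail (suc a)) m) (treeTail-coeff m (runSeries-coeff m) (suc a)))

  -- Both numbers are the coefficient of `G` at `n + 1`; the index drops by one for runs because the
  -- root is already present.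
  walkCount≡runCount : ∀ n → walkCount 0 (suc n) ≡ runCount 1 false n
  walkCount≡runCount n = ℤₚ.+-injective (begin
    + walkCount 0 (suc n)            ≡⟨ walkSeries-coeff (suc n) 0 ⟨
    coeff G (suc n)                  ≡⟨ at G≋ (suc n) ⟩
    coeff (X ⊛ freshSeries 1) (suc n) ≡⟨ X⊛-suc (freshSeries 1) n ⟩
    coeff (freshSeries 1) n          ≡⟨ runSeries-coeff n 1 false ⟩
    + runCount 1 false n             ∎)
    where
    open ≡-Reasoning
    G≋ : G ≋ X ⊛ freshSeries 1
    G≋ = R.trans first-tree (R.trans
      (solve 4 (λ t α β γ → t :* (𝟏 :+ α) := t :* (𝟏 :+ (α :* 𝟏 :+ β :* con 0ℤ :+ γ :* con 0ℤ))) R.refl X′ α β γ)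
      (R.sym (X⊛≋X′⊛ _)))

open PowerSeries using (walkCount≡runCount)

-- Finite cardinalities

Size : Set → ℕ → Set
Size A n = A ↔ Fin n

size-⊎ : ∀ {A B m n} → Size A m → Size B n → Size (A ⊎ B) (m + n)
size-⊎ f g = ↔-trans (f ⊎-↔ g) (↔-sym +↔⊎)

size-empty : ∀ {A : Set} → ¬ A → Size A 0
size-empty ¬A = ↔-trans (mk↔ₛ′ ¬A (λ ()) (λ ()) (λ a → contradiction a ¬A)) (↔-sym 0↔⊥)

size-singleton : ∀ {A : Set} (a : A) → (∀ a′ → a ≡ a′) → Size A 1
size-singleton a unique = ↔-trans (mk↔ₛ′ (λ _ → tt) (λ _ → a) (λ _ → refl) unique) (↔-sym 1↔⊤)

size-sum< : ∀ (F : ℕ → Set) {f} → (∀ i → Size (F i) (f i)) → ∀ n → Size (∃ λ i → i < n × F i) (sum< n f)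
size-sum< F F≅f zero    = size-empty λ ()
size-sum< F F≅f (suc n) = ↔-trans (mk↔ₛ′ split join split-join join-split) (size-⊎ (size-sum< F F≅f n) (F≅f n))
  where
  split : (∃ λ i → i < suc n × F i) → (∃ λ i → i < n × F i) ⊎ F n
  split (i , i<1+n , a) with m<1+n⇒m<n∨m≡n i<1+n
  ... | inj₁ i<n  = inj₁ (i , i<n , a)
  ... | inj₂ refl = inj₂ a
  join : (∃ λ i → i < n × F i) ⊎ F n → ∃ λ i → i < suc n × F i
  join (inj₁ (i , i<n , a)) = i , m<n⇒m<1+n i<n , a
  join (inj₂ a)             = n , ≤-refl , a
  split-join : ∀ s → split (join s) ≡ s
  split-join (inj₁ (i , i<n , a)) with m<1+n⇒m<n∨m≡n (m<n⇒m<1+n i<n)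
  ... | inj₁ i<n′ = cong (λ p → inj₁ (i , p , a)) (<-irrelevant i<n′ i<n)
  ... | inj₂ refl = contradiction i<n (<-irrefl refl)
  split-join (inj₂ a) with m<1+n⇒m<n∨m≡n {n} ≤-refl
  ... | inj₁ n<n  = contradiction n<n (<-irrefl refl)
  ... | inj₂ refl = refl
  join-split : ∀ t → join (split t) ≡ t
  join-split (i , i<1+n , a) with m<1+n⇒m<n∨m≡n i<1+n
  ... | inj₁ i<n  = cong (λ p → i , p , a) (<-irrelevant _ _)
  ... | inj₂ refl = cong (λ p → i , p , a) (<-irrelevant _ _)

-- Walks and runs counted by their first step

Walk : ℕ → ℕ → Set
Walk k n = Σ (Vec Step n) λ ss → T (positiveTo1From (+ k) ss)

WalkVia : ℕ → ℕ → Step → Set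
WalkVia k n s = Σ (Vec Step n) λ ss → T (positiveTo1From (+ k) (s ∷ ss))

walk-steps : ∀ k n → Walk k (suc n) ↔
  (((WalkVia k n down2 ⊎ WalkVia k n down1) ⊎ WalkVia k n up1) ⊎ WalkVia k n up2)
walk-steps k n = mk↔ₛ′
  (λ { (down2 ∷ ss , p) → inj₁ (inj₁ (inj₁ (ss , p))) ; (down1 ∷ ss , p) → inj₁ (inj₁ (inj₂ (ss , p)))
     ; (up1 ∷ ss , p) → inj₁ (inj₂ (ss , p)) ; (up2 ∷ ss , p) → inj₂ (ss , p) })
  (λ { (inj₁ (inj₁ (inj₁ (ss , p)))) → down2 ∷ ss , p ; (inj₁ (inj₁ (inj₂ (ss , p)))) → down1 ∷ ss , p
     ; (inj₁ (inj₂ (ss , p))) → up1 ∷ ss , p ; (inj₂ (ss , p)) → up2 ∷ ss , p })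
  (λ { (inj₁ (inj₁ (inj₁ (ss , p)))) → refl ; (inj₁ (inj₁ (inj₂ (ss , p)))) → refl
     ; (inj₁ (inj₂ (ss , p))) → refl ; (inj₂ (ss , p)) → refl })
  (λ { (down2 ∷ ss , p) → refl ; (down1 ∷ ss , p) → refl ; (up1 ∷ ss , p) → refl ; (up2 ∷ ss , p) → refl })

size-steps : ∀ {k n a b c d} → Size (WalkVia k n down2) a → Size (WalkVia k n down1) b →
  Size (WalkVia k n up1) c → Size (WalkVia k n up2) d → Size (Walk k (suc n)) (a + b + c + d)
size-steps s₁ s₂ s₃ s₄ = ↔-trans (walk-steps _ _) (size-⊎ (size-⊎ (size-⊎ s₁ s₂) s₃) s₄)

-- At a variable height, `+ k` plus the step is not literally of the form `+ (suc j + k)`, hence the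
-- transport along commutativity.
size-up : ∀ {k n m} s j → stepVal s ≡ + suc j → Size (Walk (suc j + k) n) m → Size (WalkVia k n s) m
size-up {k} {n} {m} s j s≡ = subst
  (λ w → Size (Σ (Vec Step n) λ ss → T (⌊ + 0 ℤ.<? w ⌋ ∧ positiveTo1From w ss)) m)
  (trans (ℤₚ.+-comm (+ suc j) (+ k)) (cong (ℤ._+_ (+ k)) (sym s≡)))

size-walk : ∀ n k → Size (Walk k n) (walkCount k n)
size-walk zero 0 = size-empty λ { ([] , ()) }
size-walk zero 1 = size-singleton ([] , tt) λ { ([] , tt) → refl }
size-walk zero (suc (suc k)) = size-empty λ { ([] , ()) }
size-walk (suc n) 0 = size-steps (size-empty λ ()) (size-empty λ ()) (size-walk n 1) (size-walk n 2)
size-walk (suc n) 1 = size-steps (size-empty λ ()) (size-empty λ ()) (size-walk n 2) (size-walk n 3)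
size-walk (suc n) 2 = size-steps (size-empty λ ()) (size-walk n 1) (size-walk n 3) (size-walk n 4)
size-walk (suc n) (suc (suc (suc k))) = size-steps (size-walk n (1 + k)) (size-walk n (2 + k))
  (size-up up1 0 refl (size-walk n (4 + k))) (size-up up2 1 refl (size-walk n (5 + k)))

-- In a state (a , b) the last label is p + a, where p is the label of the parent of the last vertex,
-- and b tells whether p can take another child. The next vertex is labelled p + e + 1 and hung below
-- the label c + 1 smaller (fresh), or labelled p + i + 1 and hung below p (same).
data Run : ℕ → Bool → ℕ → Set where
  stop  : ∀ {a b} → Run a b zero
  fresh : ∀ {a b m} e → e < suc a → ∀ c → c < e → Run (suc c) true m → Run a b (suc m)
  same  : ∀ {a m} i → i < suc a → Run (suc i) false m → Run a true (suc m)

Fresh Same : ℕ → ℕ → Set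
Fresh a m = ∃ λ e → e < suc a × ∃ λ c → c < e × Run (suc c) true m
Same a m = ∃ λ i → i < suc a × Run (suc i) false m

run-steps : ∀ a b m → Run a b (suc m) ↔ (Fresh a m ⊎ (if b then Same a m else ⊥))
run-steps a true m = mk↔ₛ′
  (λ { (fresh e p c q r) → inj₁ (e , p , c , q , r) ; (same i p r) → inj₂ (i , p , r) })
  (λ { (inj₁ (e , p , c , q , r)) → fresh e p c q r ; (inj₂ (i , p , r)) → same i p r })
  (λ { (inj₁ _) → refl ; (inj₂ _) → refl })
  (λ { (fresh e p c q r) → refl ; (same i p r) → refl })
run-steps a false m = mk↔ₛ′
  (λ { (fresh e p c q r) → inj₁ (e , p , c , q , r) })
  (λ { (inj₁ (e , p , c , q , r)) → fresh e p c q r })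
  (λ { (inj₁ _) → refl })
  (λ { (fresh e p c q r) → refl })

size-run : ∀ m a b → Size (Run a b m) (runCount a b m)
size-run zero a b = size-singleton stop λ { stop → refl }
size-run (suc m) a b = ↔-trans (run-steps a b m)
  (size-⊎ (size-sum< (λ e → ∃ λ c → c < e × Run (suc c) true m)
              (size-sum< (λ c → Run (suc c) true m) λ c → size-run m (suc c) true) (suc a))
          (size-same b))
  where
  size-same : ∀ b → Size (if b then Same a m else ⊥) (if b then (sum< (suc a) λ i → runCount (suc i) false m) else 0)
  size-same true  = size-sum< (λ i → Run (suc i) false m) (λ i → size-run m (suc i) false) (suc a)
  size-same false = size-empty λ ()

-- The order embedding of the naturals that skips one value, and its inverse

shift unshift : ℕ → ℕ → ℕ
shift zero    x       = suc x
shift (suc v) zero    = zero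
shift (suc v) (suc x) = suc (shift v x)
unshift zero    x       = pred x
unshift (suc v) zero    = zero
unshift (suc v) (suc x) = suc (unshift v x)

shift-< : ∀ {v x} → x < v → shift v x ≡ x
shift-< {suc v} {zero}  _         = refl
shift-< {suc v} {suc x} (s≤s x<v) = cong suc (shift-< x<v)

shift-≥ : ∀ {v x} → v ≤ x → shift v x ≡ suc x
shift-≥ {zero}          _         = refl
shift-≥ {suc v} {suc x} (s≤s v≤x) = cong suc (shift-≥ v≤x)

shift-mono-< : ∀ v {x y} → x < y → shift v x < shift v y
shift-mono-< zero                    x<y       = s≤s x<y
shift-mono-< (suc v) {zero}  {suc y} _         = s≤s z≤n
shift-mono-< (suc v) {suc x} {suc y} (s≤s x<y) = s≤s (shift-mono-< v x<y)

shift-cancel-< : ∀ v {x y} → shift v x < shift v y → x < y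
shift-cancel-< zero                    (s≤s x<y) = x<y
shift-cancel-< (suc v) {zero}  {suc y} _         = s≤s z≤n
shift-cancel-< (suc v) {suc x} {suc y} (s≤s x<y) = s≤s (shift-cancel-< v x<y)

shift-injective : ∀ v {x y} → shift v x ≡ shift v y → x ≡ y
shift-injective zero                    eq = suc-injective eq
shift-injective (suc v) {zero}  {zero}  eq = refl
shift-injective (suc v) {suc x} {suc y} eq = cong suc (shift-injective v (suc-injective eq))

shift-≢ : ∀ v {x} → shift v x ≢ v
shift-≢ (suc v) {suc x} eq = shift-≢ v (suc-injective eq)

≤-shift : ∀ v x → x ≤ shift v x
≤-shift zero    x       = n≤1+n x
≤-shift (suc v) zero    = z≤n
≤-shift (suc v) (suc x) = s≤s (≤-shift v x)

shift-≤ : ∀ v x → shift v x ≤ suc x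
shift-≤ zero    x       = ≤-refl
shift-≤ (suc v) zero    = z≤n
shift-≤ (suc v) (suc x) = s≤s (shift-≤ v x)

shift-unshift : ∀ v {x} → x ≢ v → shift v (unshift v x) ≡ x
shift-unshift zero    {zero}  x≢v = contradiction refl x≢v
shift-unshift zero    {suc x} x≢v = refl
shift-unshift (suc v) {zero}  x≢v = refl
shift-unshift (suc v) {suc x} x≢v = cong suc (shift-unshift v (x≢v ∘ cong suc))

-- Pattern avoidance and inversions

data Before (x y : ℕ) : List ℕ → Set where
  here  : ∀ {σ} → y ∈ σ → Before x y (x ∷ σ)
  there : ∀ {z σ} → Before x y σ → Before x y (z ∷ σ)

before-∈ˡ : ∀ {x y σ} → Before x y σ → x ∈ σ
before-∈ˡ (here _)  = here refl
before-∈ˡ (there b) = there (before-∈ˡ b)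

before-≢ : ∀ {x y σ} → Unique σ → Before x y σ → x ≢ y
before-≢ (x≢ ∷ _) (here y∈) = All.lookup x≢ y∈
before-≢ (_ ∷ u)  (there b) = before-≢ u b

before-++ : ∀ {x y σ} τ → x ∈ σ → y ∈ τ → Before x y (σ ++ τ)
before-++ {σ = z ∷ σ} τ (here refl) y∈ = here (∈-++⁺ʳ σ y∈)
before-++ τ (there x∈) y∈ = there (before-++ τ x∈ y∈)

before-++ˡ : ∀ {x y σ} τ → Before x y σ → Before x y (σ ++ τ)
before-++ˡ τ (here y∈) = here (∈-++⁺ˡ y∈)
before-++ˡ τ (there b) = there (before-++ˡ τ b)

before-∷ʳ⁻ : ∀ {x y v} σ → Before x y (σ ∷ʳ v) → Before x y σ ⊎ (x ∈ σ × y ≡ v)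
before-∷ʳ⁻ [] (here ())
before-∷ʳ⁻ [] (there ())
before-∷ʳ⁻ (z ∷ σ) (here y∈) with ∈-++⁻ σ y∈
... | inj₁ y∈σ         = inj₁ (here y∈σ)
... | inj₂ (here refl) = inj₂ (here refl , refl)
before-∷ʳ⁻ (z ∷ σ) (there b) with before-∷ʳ⁻ σ b
... | inj₁ b′          = inj₁ (there b′)
... | inj₂ (x∈ , y≡v) = inj₂ (there x∈ , y≡v)

before-map⁺ : ∀ f {x y σ} → Before x y σ → Before (f x) (f y) (map f σ)
before-map⁺ f (here y∈) = here (∈-map⁺ f y∈)
before-map⁺ f (there b) = there (before-map⁺ f b)

before-map⁻ : ∀ f {x y} σ → Before x y (map f σ) → ∃₂ λ x₀ y₀ → x ≡ f x₀ × y ≡ f y₀ × Before x₀ y₀ σ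
before-map⁻ f (z ∷ σ) (here y∈) with y₀ , y₀∈ , y≡ ← ∈-map⁻ f y∈ = z , y₀ , refl , y≡ , here y₀∈
before-map⁻ f (z ∷ σ) (there b) with x₀ , y₀ , p , q , b₀ ← before-map⁻ f σ b = x₀ , y₀ , p , q , there b₀

Avoiding : List ℕ → Set
Avoiding []      = ⊤
Avoiding (x ∷ σ) = (∀ {y z} → Before y z σ → y < x → ¬ x < z) × Avoiding σ

-- In other words, the entries up to `k` occur in increasing order.
InversionsAbove : ℕ → List ℕ → Set
InversionsAbove k σ = ∀ {x y} → Before x y σ → y < x → k < x

avoiding-map⁺ : ∀ {f} → (∀ {x y} → f x < f y → x < y) → ∀ σ → Avoiding σ → Avoiding (map f σ)
avoiding-map⁺ f-cancel [] _ = tt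
avoiding-map⁺ {f} f-cancel (x ∷ σ) (av , avs) = av′ , avoiding-map⁺ f-cancel σ avs
  where
  av′ : ∀ {y z} → Before y z (map f σ) → y < f x → ¬ f x < z
  av′ b p q with _ , _ , refl , refl , b₀ ← before-map⁻ f σ b = av b₀ (f-cancel p) (f-cancel q)

avoiding-map⁻ : ∀ {f} → (∀ {x y} → x < y → f x < f y) → ∀ σ → Avoiding (map f σ) → Avoiding σ
avoiding-map⁻ f-mono [] _ = tt
avoiding-map⁻ {f} f-mono (x ∷ σ) (av , avs) =
  (λ b p q → av (before-map⁺ f b) (f-mono p) (f-mono q)) , avoiding-map⁻ f-mono σ avs

-- A pattern 213 created by appending `v` must use `v` as its largest entry.
avoiding-∷ʳ⁺ : ∀ {v} σ → Avoiding σ → (∀ {x y} → Before x y σ → y < x → ¬ x < v) → Avoiding (σ ∷ʳ v)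
avoiding-∷ʳ⁺ [] _ _ = (λ ()) , tt
avoiding-∷ʳ⁺ {v} (x ∷ σ) (av , avs) noInv = av′ , avoiding-∷ʳ⁺ σ avs (noInv ∘ there)
  where
  av′ : ∀ {y z} → Before y z (σ ∷ʳ v) → y < x → ¬ x < z
  av′ b with before-∷ʳ⁻ σ b
  ... | inj₁ b′          = av b′
  ... | inj₂ (y∈ , refl) = noInv (here y∈)

avoiding-∷ʳ⁻ : ∀ {v} σ → Avoiding (σ ∷ʳ v) → Avoiding σ × (∀ {x y} → Before x y σ → y < x → ¬ x < v)
avoiding-∷ʳ⁻ [] _ = tt , λ ()
avoiding-∷ʳ⁻ {v} (x ∷ σ) (av , avs) with avσ , noInv ← avoiding-∷ʳ⁻ σ avs =
  ((λ b → av (before-++ˡ (v ∷ []) b)) , avσ) , λ where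
    (here y∈) p q → av (before-++ (v ∷ []) y∈ (here refl)) p q
    (there b)     → noInv b

-- An inversion whose larger entry lies below the last entry `v` would form 213 together with `v`;
-- equality with `v` is excluded by uniqueness.
inversionsAbove-last : ∀ {v} σ → Unique (σ ∷ʳ v) → Avoiding (σ ∷ʳ v) → InversionsAbove v (σ ∷ʳ v)
inversionsAbove-last {v} σ u av {x} b y<x with before-∷ʳ⁻ σ b
... | inj₂ (_ , refl) = y<x
... | inj₁ b′ = ≤∧≢⇒< (≮⇒≥ (proj₂ (avoiding-∷ʳ⁻ σ av) b′ y<x))
                      (before-≢ u (before-++ (v ∷ []) (before-∈ˡ b′) (here refl)) ∘ sym)

-- Trees as words in breadth-first order

data Arity : Set where
  leaf unary binary : Arity

Word : Set
Word = List (ℕ × Arity)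

labelsOf : Word → List ℕ
labelsOf = map proj₁

-- The value at binary is irrelevant to the trees; it makes inc injective.
inc : Arity → Arity
inc leaf   = unary
inc unary  = binary
inc binary = leaf

inc-injective : ∀ {s s′} → inc s ≡ inc s′ → s ≡ s′
inc-injective {leaf}   {leaf}   _ = refl
inc-injective {unary}  {unary}  _ = refl
inc-injective {binary} {binary} _ = refl

Leaves : Word → Set
Leaves = All λ p → proj₂ p ≡ leaf

relabel : (ℕ → ℕ) → ℕ × Arity → ℕ × Arity
relabel f (x , s) = f x , s

-- The comparison with `ℓ` uses the label before the shift. Legal moves have `ℓ < v`, so the shift
-- fixes `ℓ`.
move : ℕ → ℕ → ℕ × Arity → ℕ × Arity
move v ℓ (x , s) = shift v x , (if x ≡ᵇ ℓ then inc s else s)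

grow : ℕ → ℕ → Word → Word
grow v ℓ w = map (move v ℓ) w ∷ʳ (v , leaf)

labelsOf-relabel : ∀ f w → labelsOf (map (relabel f) w) ≡ map f (labelsOf w)
labelsOf-relabel f []      = refl
labelsOf-relabel f (_ ∷ w) = cong (_ ∷_) (labelsOf-relabel f w)

labelsOf-grow : ∀ v ℓ w → labelsOf (grow v ℓ w) ≡ map (shift v) (labelsOf w) ∷ʳ v
labelsOf-grow v ℓ []      = refl
labelsOf-grow v ℓ (_ ∷ w) = cong (_ ∷_) (labelsOf-grow v ℓ w)

leaves-relabel : ∀ f {w} → Leaves w → Leaves (map (relabel f) w)
leaves-relabel f = Allₚ.map⁺

≡ᵇ-refl : ∀ x → (x ≡ᵇ x) ≡ true
≡ᵇ-refl zero    = refl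
≡ᵇ-refl (suc x) = ≡ᵇ-refl x

≢⇒≡ᵇ : ∀ {x y} → x ≢ y → (x ≡ᵇ y) ≡ false
≢⇒≡ᵇ {zero}  {zero}  x≢y = contradiction refl x≢y
≢⇒≡ᵇ {zero}  {suc y} x≢y = refl
≢⇒≡ᵇ {suc x} {zero}  x≢y = refl
≢⇒≡ᵇ {suc x} {suc y} x≢y = ≢⇒≡ᵇ (x≢y ∘ cong suc)

move-off : ∀ v {ℓ} w → ℓ ∉ labelsOf w → map (move v ℓ) w ≡ map (relabel (shift v)) w
move-off v [] _ = refl
move-off v ((x , s) ∷ w) ℓ∉ rewrite ≢⇒≡ᵇ (ℓ∉ ∘ here ∘ sym) = cong (_ ∷_) (move-off v w (ℓ∉ ∘ there))

unique-split : ∀ u {p z} → Unique (labelsOf (u ++ p ∷ z)) → proj₁ p ∉ labelsOf u × proj₁ p ∉ labelsOf z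
unique-split [] (p≢ ∷ _) = (λ ()) , λ p∈ → All.lookup p≢ p∈ refl
unique-split (_ ∷ u) {p} {z} (x≢ ∷ uq) with p∉u , p∉z ← unique-split u uq =
  (λ { (here refl) → All.lookup x≢ (∈-map⁺ proj₁ (∈-++⁺ʳ u (here refl))) refl ; (there p∈) → p∉u p∈ }) , p∉z

grow-split : ∀ {v ℓ s} u z → Unique (labelsOf (u ++ (ℓ , s) ∷ z)) → ℓ < v →
  grow v ℓ (u ++ (ℓ , s) ∷ z) ≡
    map (relabel (shift v)) u ++ (ℓ , inc s) ∷ map (relabel (shift v)) z ∷ʳ (v , leaf)
grow-split {v} {ℓ} {s} u z uq ℓ<v with ℓ∉u , ℓ∉z ← unique-split u uq
  rewrite map-++ (move v ℓ) u ((ℓ , s) ∷ z) | move-off v u ℓ∉u | move-off v z ℓ∉z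
        | ≡ᵇ-refl ℓ | shift-< ℓ<v = ++-assoc (map (relabel (shift v)) u) _ _

move-injective : ∀ v ℓ {p p′} → move v ℓ p ≡ move v ℓ p′ → p ≡ p′
move-injective v ℓ {x , s} {x′ , s′} eq with refl ← shift-injective v (cong proj₁ eq) with x ≡ᵇ ℓ
... | true  = cong (x ,_) (inc-injective (cong proj₂ eq))
... | false = cong (x ,_) (cong proj₂ eq)

-- The appended entry reveals `v`. With `ℓ` known, the incremented position is known too, and `inc`
-- is injective.
grow-injective : ∀ {v v′ ℓ} w w′ → grow v ℓ w ≡ grow v′ ℓ w′ → v ≡ v′ × w ≡ w′
grow-injective {v} {ℓ = ℓ} w w′ eq with ∷ʳ-injective _ _ eq
... | eq₁ , refl = refl , map-injective (move-injective v ℓ) eq₁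

-- The queue of parents

kids : ℕ → Arity → List ℕ
kids x leaf   = []
kids x unary  = x ∷ []
kids x binary = x ∷ x ∷ []

-- The first argument queues, in breadth-first order, the label of the parent of each vertex to come.
data Increasing : List ℕ → Word → Set where
  []  : Increasing [] []
  _∷_ : ∀ {y ps x s w} → y < x → Increasing (ps ++ kids x s) w → Increasing (y ∷ ps) ((x , s) ∷ w)

kids-map : ∀ f x s → map f (kids x s) ≡ kids (f x) s
kids-map f x leaf   = refl
kids-map f x unary  = refl
kids-map f x binary = refl

increasing-relabel⁺ : ∀ {f} → (∀ {x y} → x < y → f x < f y) →
  ∀ {ps w} → Increasing ps w → Increasing (map f ps) (map (relabel f) w)
increasing-relabel⁺ f-mono [] = []
increasing-relabel⁺ {f} f-mono {_ ∷ ps} {(x , s) ∷ w} (y<x ∷ i) = f-mono y<x ∷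
  subst (λ qs → Increasing qs _) (trans (map-++ f ps _) (cong (map f ps ++_) (kids-map f x s))) (increasing-relabel⁺ f-mono i)

increasing-relabel⁻ : ∀ {f} → (∀ {x y} → f x < f y → x < y) →
  ∀ ps w → Increasing (map f ps) (map (relabel f) w) → Increasing ps w
increasing-relabel⁻ f-cancel [] [] [] = []
increasing-relabel⁻ {f} f-cancel (_ ∷ ps) ((x , s) ∷ w) (y<x ∷ i) = f-cancel y<x ∷
  increasing-relabel⁻ f-cancel _ w
    (subst (λ qs → Increasing qs _) (sym (trans (map-++ f ps _) (cong (map f ps ++_) (kids-map f x s)))) i)

-- The arities that admit one more child; the flag tells whether there is room for yet another one
-- afterwards.
data Opens : Arity → Bool → Set where
  leaf  : Opens leaf true
  unary : Opens unary false

++-kids-inc : ∀ ps {s b} → Opens s b → ∀ x → (ps ++ kids x s) ∷ʳ x ≡ ps ++ kids x (inc s)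
++-kids-inc ps leaf  x = ++-assoc ps [] (x ∷ [])
++-kids-inc ps unary x = ++-assoc ps (x ∷ []) (x ∷ [])

-- Leaves add nothing to the queue, so an entry put at its back waits until they are all read and
-- becomes the parent of the appended vertex.
increasing-leaves⁺ : ∀ {ℓ v ps z} → ℓ < v → Leaves z → Increasing ps z → Increasing (ps ∷ʳ ℓ) (z ∷ʳ (v , leaf))
increasing-leaves⁺ ℓ<v [] [] = ℓ<v ∷ []
increasing-leaves⁺ {ps = _ ∷ ps} ℓ<v (refl ∷ lz) (y<x ∷ i) rewrite ++-identityʳ ps =
  y<x ∷ subst (λ qs → Increasing qs _) (sym (++-identityʳ _)) (increasing-leaves⁺ ℓ<v lz i)

increasing-leaves⁻ : ∀ {ℓ v z} ps → Leaves z → Increasing (ps ∷ʳ ℓ) (z ∷ʳ (v , leaf)) → ℓ < v × Increasing ps z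
increasing-leaves⁻ [] [] (ℓ<v ∷ []) = ℓ<v , []
increasing-leaves⁻ (_ ∷ []) [] (_ ∷ ())
increasing-leaves⁻ (_ ∷ _ ∷ _) [] (_ ∷ ())
increasing-leaves⁻ {z = _ ∷ []}    [] (refl ∷ _) (_ ∷ ())
increasing-leaves⁻ {z = _ ∷ _ ∷ _} [] (refl ∷ _) (_ ∷ ())
increasing-leaves⁻ (_ ∷ ps) (refl ∷ lz) (y<x ∷ i)
  with ℓ<v , i′ ← increasing-leaves⁻ ps lz (subst (λ qs → Increasing qs _) (++-identityʳ _) i) =
  ℓ<v , y<x ∷ subst (λ qs → Increasing qs _) (sym (++-identityʳ ps)) i′

increasing-grow⁺ : ∀ {ℓ v s b z} u {ps} → ℓ < v → Opens s b → Leaves z →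
  Increasing ps (u ++ (ℓ , s) ∷ z) → Increasing ps (u ++ (ℓ , inc s) ∷ z ∷ʳ (v , leaf))
increasing-grow⁺ [] {_ ∷ ps} ℓ<v o lz (y<x ∷ i) =
  y<x ∷ subst (λ qs → Increasing qs _) (++-kids-inc ps o _) (increasing-leaves⁺ ℓ<v lz i)
increasing-grow⁺ (_ ∷ u) ℓ<v o lz (y<x ∷ i) = y<x ∷ increasing-grow⁺ u ℓ<v o lz i

increasing-grow⁻ : ∀ {ℓ v s b z} u {ps} → Opens s b → Leaves z →
  Increasing ps (u ++ (ℓ , inc s) ∷ z ∷ʳ (v , leaf)) → ℓ < v × Increasing ps (u ++ (ℓ , s) ∷ z)
increasing-grow⁻ [] {_ ∷ ps} o lz (y<x ∷ i)
  with ℓ<v , i′ ← increasing-leaves⁻ (ps ++ _) lz (subst (λ qs → Increasing qs _) (sym (++-kids-inc ps o _)) i) =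
  ℓ<v , y<x ∷ i′
increasing-grow⁻ (_ ∷ u) o lz (y<x ∷ i) with ℓ<v , i′ ← increasing-grow⁻ u o lz i = ℓ<v , y<x ∷ i′

-- The queue has to be empty after the last vertex.
increasing-last : ∀ {v s} w {ps} → Increasing ps (w ∷ʳ (v , s)) → s ≡ leaf
increasing-last {s = leaf}   w       _ = refl
increasing-last {s = unary}  [] {_ ∷ []}    (_ ∷ ())
increasing-last {s = unary}  [] {_ ∷ _ ∷ _} (_ ∷ ())
increasing-last {s = binary} [] {_ ∷ []}    (_ ∷ ())
increasing-last {s = binary} [] {_ ∷ _ ∷ _} (_ ∷ ())
increasing-last {s = unary}  (_ ∷ w) (_ ∷ i) = increasing-last w i
increasing-last {s = binary} (_ ∷ w) (_ ∷ i) = increasing-last w i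

-- The last vertex with children

data LastInternal (w : Word) : Set where
  none : Leaves w → LastInternal w
  some : ∀ u {ℓ s b} z → Opens s b → Leaves z → w ≡ u ++ (ℓ , inc s) ∷ z → LastInternal w

lastInternal : ∀ w → LastInternal w
lastInternal [] = none []
lastInternal ((x , s) ∷ w) with lastInternal w
... | some u z o lz refl = some ((x , s) ∷ u) z o lz refl
... | none lw with s
...   | leaf   = none (refl ∷ lw)
...   | unary  = some [] w leaf lw refl
...   | binary = some [] w unary lw refl

internal-not-leaf : ∀ {s b} → Opens s b → inc s ≢ leaf
internal-not-leaf leaf  ()
internal-not-leaf unary ()

lastInternal-unique : ∀ u u′ {ℓ ℓ′ s s′ z z′} → s ≢ leaf → s′ ≢ leaf → Leaves z → Leaves z′ →
  u ++ (ℓ , s) ∷ z ≡ u′ ++ (ℓ′ , s′) ∷ z′ → ℓ ≡ ℓ′ × s ≡ s′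
lastInternal-unique [] [] _ _ _ _ refl = refl , refl
lastInternal-unique [] (_ ∷ u′) _ s′≢ lz _ refl = contradiction (All.lookup lz (∈-++⁺ʳ u′ (here refl))) s′≢
lastInternal-unique (_ ∷ u) [] s≢ _ _ lz′ refl = contradiction (All.lookup lz′ (∈-++⁺ʳ u (here refl))) s≢
lastInternal-unique (_ ∷ u) (_ ∷ u′) p q lz lz′ eq = lastInternal-unique u u′ p q lz lz′ (proj₂ (∷-injective eq))

internal-before-leaf : ∀ u u′ {ℓ ℓ′ s z z′} → s ≢ leaf → Leaves z′ →
  u ++ (ℓ , s) ∷ z ≡ u′ ++ (ℓ′ , leaf) ∷ z′ → Before ℓ ℓ′ (labelsOf (u ++ (ℓ , s) ∷ z))
internal-before-leaf [] [] s≢ _ refl = contradiction refl s≢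
internal-before-leaf [] (_ ∷ u′) s≢ _ refl = here (∈-map⁺ proj₁ (∈-++⁺ʳ u′ (here refl)))
internal-before-leaf (_ ∷ u) [] s≢ lz′ refl = contradiction (All.lookup lz′ (∈-++⁺ʳ u (here refl))) s≢
internal-before-leaf (_ ∷ u) (_ ∷ u′) s≢ lz′ eq with refl , eq′ ← ∷-injective eq =
  there (internal-before-leaf u u′ s≢ lz′ eq′)

-- Valid words and their legal extensions

record Valid (n : ℕ) (w : Word) : Set where
  field
    length-≡   : length w ≡ n
    bounded    : All (λ x → 0 < x × x ≤ n) (labelsOf w)
    unique     : Unique (labelsOf w)
    complete   : ∀ {x} → 0 < x → x ≤ n → x ∈ labelsOf w
    -- The queue starts with 0 as a fictitious parent of the root; it is below all labels and fixed
    -- by `shift v` for positive `v`.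
    parents-<  : Increasing (0 ∷ []) w
    avoiding   : Avoiding (labelsOf w)
open Valid

-- The label of the last vertex with children, and whether it has exactly one; 0 if there is none.
data Parent (w : Word) : ℕ → Bool → Set where
  none : Leaves w → Parent w 0 false
  some : ∀ u {ℓ s b} z → Opens s b → Leaves z → w ≡ u ++ (ℓ , inc s) ∷ z → Parent w ℓ b

record State (k p : ℕ) (b : Bool) (w : Word) : Set where
  field
    parent   : Parent w p b
    init     : Word
    init∷ʳ   : w ≡ init ∷ʳ (k , leaf)
    parent-≤ : p ≤ k
open State

-- Only leaves may follow the new parent, since otherwise the new vertex would not come last in
-- breadth-first order. The bound on `v` reflects the avoidance of 213.
record Legal (k : ℕ) (w : Word) (v ℓ : ℕ) (b : Bool) : Set where
  field
    {before after} : Word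
    {slot}   : Arity
    split    : w ≡ before ++ (ℓ , slot) ∷ after
    opens    : Opens slot b
    leaves   : Leaves after
    parent-< : ℓ < v
    label-≤  : v ≤ suc k
open Legal

labelsOf-∷ʳ : ∀ w {k s} → labelsOf (w ∷ʳ (k , s)) ≡ labelsOf w ∷ʳ k
labelsOf-∷ʳ w = map-++ proj₁ w _

labelsOf-resplit : ∀ u {ℓ s s′ z} → labelsOf (u ++ (ℓ , s) ∷ z) ≡ labelsOf (u ++ (ℓ , s′) ∷ z)
labelsOf-resplit []      = refl
labelsOf-resplit (_ ∷ u) = cong (_ ∷_) (labelsOf-resplit u)

unique-∷ʳ⁻ : ∀ {σ : List ℕ} {v} → Unique (σ ∷ʳ v) → Unique σ × v ∉ σ
unique-∷ʳ⁻ {[]} _ = [] , λ ()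
unique-∷ʳ⁻ {x ∷ σ} (x≢ ∷ u) with uσ , v∉σ ← unique-∷ʳ⁻ u =
  Allₚ.++⁻ˡ σ x≢ ∷ uσ , λ { (here refl) → All.lookup x≢ (∈-++⁺ʳ σ (here refl)) refl ; (there v∈) → v∉σ v∈ }

unique-∷ʳ⁺ : ∀ {σ : List ℕ} {v} → Unique σ → v ∉ σ → Unique (σ ∷ʳ v)
unique-∷ʳ⁺ u v∉ = Uniqueₚ.++⁺ u ([] ∷ []) λ { (x∈ , here refl) → v∉ x∈ }

last-inversions : ∀ {n k p b w} → Valid n w → State k p b w → InversionsAbove k (labelsOf w)
last-inversions {k = k} {w = w} g st = subst (InversionsAbove k) (sym eq)
  (inversionsAbove-last _ (subst Unique eq (unique g)) (subst Avoiding eq (avoiding g)))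
  where
  eq : labelsOf w ≡ labelsOf (init st) ∷ʳ k
  eq = trans (cong labelsOf (init∷ʳ st)) (labelsOf-∷ʳ (init st))

last-∈ : ∀ {k p b w} → State k p b w → k ∈ labelsOf w
last-∈ st = subst (λ w → _ ∈ labelsOf w) (sym (init∷ʳ st)) (∈-map⁺ proj₁ (∈-++⁺ʳ (init st) (here refl)))

module _ {n k p b w v ℓ b′} (g : Valid n w) (st : State k p b w) (l : Legal k w v ℓ b′) where

  private
    k≤n : k ≤ n
    k≤n = proj₂ (All.lookup (bounded g) (last-∈ st))

    v≤1+n : v ≤ suc n
    v≤1+n = ≤-trans (label-≤ l) (s≤s k≤n)

    0<v : 0 < v
    0<v = ≤-<-trans z≤n (parent-< l)

    grown : grow v ℓ w ≡ (map (relabel (shift v)) (before l) ++ (ℓ , inc (slot l)) ∷ map (relabel (shift v)) (after l)) ∷ʳ (v , leaf)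
    grown = trans (subst (λ w → grow v ℓ w ≡ _) (sym (split l))
      (grow-split (before l) (after l) (subst (Unique ∘ labelsOf) (split l) (unique g)) (parent-< l)))
      (sym (++-assoc (map (relabel (shift v)) (before l)) _ _))

    -- The larger label of an old inversion exceeds `k`, hence is at least `v` because `v ≤ k + 1`,
    -- and the shift lifts it above `v`.
    new-inversions : InversionsAbove v (map (shift v) (labelsOf w) ∷ʳ v)
    new-inversions c y<x with before-∷ʳ⁻ _ c
    ... | inj₂ (_ , refl) = y<x
    ... | inj₁ c′ with x₀ , y₀ , refl , refl , c₀ ← before-map⁻ (shift v) _ c′ =
      subst (v <_) (sym (shift-≥ v≤x₀)) (s≤s v≤x₀)
      where
      v≤x₀ : v ≤ x₀
      v≤x₀ = ≤-trans (label-≤ l) (last-inversions g st c₀ (shift-cancel-< v y<x))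

  grow-valid : Valid (suc n) (grow v ℓ w)
  grow-valid .length-≡ = trans (length-++ (map (move v ℓ) w))
    (trans (+-comm _ 1) (cong suc (trans (length-map (move v ℓ) w) (length-≡ g))))
  grow-valid .bounded rewrite labelsOf-grow v ℓ w = Allₚ.∷ʳ⁺
    (Allₚ.map⁺ (All.map (λ {x} (0<x , x≤n) → <-≤-trans 0<x (≤-shift v x) , ≤-trans (shift-≤ v x) (s≤s x≤n)) (bounded g)))
    (0<v , v≤1+n)
  grow-valid .unique rewrite labelsOf-grow v ℓ w =
    unique-∷ʳ⁺ (Uniqueₚ.map⁺ (shift-injective v) (unique g)) λ v∈ → let (_ , _ , v≡) = ∈-map⁻ (shift v) v∈ in shift-≢ v (sym v≡)
  grow-valid .complete {x} 0<x x≤1+n rewrite labelsOf-grow v ℓ w with <-cmp x v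
  ... | tri< x<v _ _ = ∈-++⁺ˡ (subst (_∈ _) (shift-< x<v) (∈-map⁺ (shift v) (complete g 0<x (s≤s⁻¹ (<-≤-trans x<v v≤1+n)))))
  ... | tri≈ _ refl _ = ∈-++⁺ʳ (map (shift v) (labelsOf w)) (here refl)
  grow-valid .complete {suc y} 0<x x≤1+n | tri> _ _ (s≤s v≤y) =
    ∈-++⁺ˡ (subst (_∈ _) (shift-≥ v≤y) (∈-map⁺ (shift v) (complete g (<-≤-trans 0<v v≤y) (s≤s⁻¹ x≤1+n))))
  grow-valid .parents-< = subst (Increasing (0 ∷ [])) (sym (trans grown (++-assoc (map (relabel (shift v)) (before l)) _ _)))
    (increasing-grow⁺ (map (relabel (shift v)) (before l)) (parent-< l) (opens l) (leaves-relabel (shift v) (leaves l))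
      (subst₂ Increasing (cong (_∷ []) (shift-< 0<v)) relabelled (increasing-relabel⁺ (shift-mono-< v) (parents-< g))))
    where
    relabelled : map (relabel (shift v)) w ≡
      map (relabel (shift v)) (before l) ++ (ℓ , slot l) ∷ map (relabel (shift v)) (after l)
    relabelled = trans (cong (map _) (split l)) (trans (map-++ _ (before l) _)
      (cong (λ ℓ′ → map (relabel (shift v)) (before l) ++ (ℓ′ , slot l) ∷ map (relabel (shift v)) (after l)) (shift-< (parent-< l))))
  grow-valid .avoiding rewrite labelsOf-grow v ℓ w = avoiding-∷ʳ⁺ _
    (avoiding-map⁺ (shift-cancel-< v) _ (avoiding g))
    (λ c y<x → <-asym (new-inversions (before-++ˡ _ c) y<x))

  grow-state : State v ℓ b′ (grow v ℓ w)
  grow-state .parent = some _ (map (relabel (shift v)) (after l) ∷ʳ (v , leaf)) (opens l)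
    (Allₚ.∷ʳ⁺ (leaves-relabel (shift v) (leaves l)) refl)
    (trans grown (++-assoc (map (relabel (shift v)) (before l)) _ _))
  grow-state .init = _
  grow-state .init∷ʳ = refl
  grow-state .parent-≤ = <⇒≤ (parent-< l)

state-unique : ∀ {k k′ p p′ b b′ w} → State k p b w → State k′ p′ b′ w → k ≡ k′ × p ≡ p′ × b ≡ b′
state-unique st st′ = cong proj₁ (proj₂ (∷ʳ-injective _ _ (trans (sym (init∷ʳ st)) (init∷ʳ st′)))) ,
  parent-unique (parent st) (parent st′)
  where
  internal∉leaves : ∀ {w u ℓ s b z} → Leaves w → Opens s b → w ≢ u ++ (ℓ , inc s) ∷ z
  internal∉leaves {u = u} lw o refl = internal-not-leaf o (All.lookup lw (∈-++⁺ʳ u (here refl)))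
  opens-unique : ∀ {s s′ b b′} → Opens s b → Opens s′ b′ → s ≡ s′ → b ≡ b′
  opens-unique leaf  leaf  _ = refl
  opens-unique unary unary _ = refl
  parent-unique : ∀ {p p′ b b′ w} → Parent w p b → Parent w p′ b′ → p ≡ p′ × b ≡ b′
  parent-unique (none _) (none _) = refl , refl
  parent-unique (none lw) (some _ _ o _ eq) = contradiction eq (internal∉leaves lw o)
  parent-unique (some _ _ o _ eq) (none lw) = contradiction eq (internal∉leaves lw o)
  parent-unique (some u z o lz eq) (some u′ z′ o′ lz′ eq′)
    with p≡ , s≡ ← lastInternal-unique u u′ (internal-not-leaf o) (internal-not-leaf o′) lz lz′ (trans (sym eq) eq′) =
    p≡ , opens-unique o o′ (inc-injective s≡)

-- The last vertex is a child of the last vertex with children, so its label is larger; this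
-- supplies `parent-≤`.
valid-state : ∀ {n w} → Valid (suc n) w → ∃₂ λ k p → ∃ λ b → State k p b w
valid-state {w = w} g with initLast w
valid-state g | [] with () ← length-≡ g
valid-state g | w₀ ∷ʳ′ (k , s) with refl ← increasing-last w₀ (parents-< g) with lastInternal w₀
... | none lw = k , 0 , false , record { parent = none (Allₚ.∷ʳ⁺ lw refl) ; init = w₀ ; init∷ʳ = refl ; parent-≤ = z≤n }
... | some u z o lz refl = k , _ , _ , record
  { parent = some u (z ∷ʳ (k , leaf)) o (Allₚ.∷ʳ⁺ lz refl) (++-assoc u _ _)
  ; init = w₀ ; init∷ʳ = refl
  ; parent-≤ = <⇒≤ (proj₁ (increasing-grow⁻ u o lz (subst (Increasing _) (++-assoc u _ _) (parents-< g)))) }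

module _ {n k p b w} (g : Valid n w) (st : State k p b w) where

  label-∈ : ∀ {ℓ} → 0 < ℓ → ℓ ≤ k → ℓ ∈ labelsOf w
  label-∈ 0<ℓ ℓ≤k = complete g 0<ℓ (≤-trans ℓ≤k (proj₂ (All.lookup (bounded g) (last-∈ st))))

  legal-same : ∀ {v} → b ≡ true → p < v → v ≤ suc k → Legal k w v p false
  legal-same b≡ p<v v≤ with parent st
  legal-same refl p<v v≤ | some u z leaf lz eq = record
    { split = eq ; opens = unary ; leaves = lz ; parent-< = p<v ; label-≤ = v≤ }

  -- A label above p and at most k cannot precede p, since it would start an inversion lying below k.
  legal-fresh : ∀ {v ℓ} → p < ℓ → ℓ < v → v ≤ suc k → Legal k w v ℓ true
  legal-fresh {v} {ℓ} p<ℓ ℓ<v v≤ with ℓ≤k ← s≤s⁻¹ (≤-trans ℓ<v v≤) with parent st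
  ... | none lw = legal-none (∈-map⁻ proj₁ (label-∈ (≤-<-trans z≤n p<ℓ) ℓ≤k))
    where
    legal-none : (∃ λ q → q ∈ w × ℓ ≡ proj₁ q) → Legal k w v ℓ true
    legal-none ((_ , s) , q∈ , refl) with u , z , eq ← ∈-∃++ q∈ with refl ← All.lookup lw q∈ = record
      { split = eq ; opens = leaf ; leaves = All.tail (Allₚ.++⁻ʳ u (subst Leaves eq lw)) ; parent-< = ℓ<v ; label-≤ = v≤ }
  ... | some u {s = s} z o lz eq = legal-some (∈-++⁻ u q∈)
    where
    entry : ∃ λ q → q ∈ w × ℓ ≡ proj₁ q
    entry = ∈-map⁻ proj₁ (label-∈ (≤-<-trans z≤n p<ℓ) ℓ≤k)
    q∈ : proj₁ entry ∈ u ++ (p , inc s) ∷ z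
    q∈ = subst (proj₁ entry ∈_) eq (proj₁ (proj₂ entry))
    ℓ≡ : ℓ ≡ proj₁ (proj₁ entry)
    ℓ≡ = proj₂ (proj₂ entry)
    legal-some : proj₁ entry ∈ u ⊎ proj₁ entry ∈ (p , inc s) ∷ z → Legal k w v ℓ true
    legal-some (inj₁ q∈u) = contradiction (last-inversions g st ℓ-before-p p<ℓ) (≤⇒≯ ℓ≤k)
      where
      ℓ-before-p : Before ℓ p (labelsOf w)
      ℓ-before-p = subst (Before ℓ p) (sym (trans (cong labelsOf eq) (map-++ proj₁ u _)))
        (before-++ _ (subst (_∈ labelsOf u) (sym ℓ≡) (∈-map⁺ proj₁ q∈u)) (here refl))
    legal-some (inj₂ (here q≡)) = contradiction p<ℓ (<-irrefl (sym (trans ℓ≡ (cong proj₁ q≡))))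
    legal-some (inj₂ (there q∈z)) with z₁ , z₂ , refl ← ∈-∃++ q∈z = record
      { before = u ++ (p , inc s) ∷ z₁ ; after = z₂ ; slot = leaf
      ; split = trans eq (trans (cong (λ q → u ++ (p , inc s) ∷ z₁ ++ q ∷ z₂)
          (cong₂ _,_ (sym ℓ≡) (All.lookup lz q∈z))) (sym (++-assoc u _ _)))
      ; opens = leaf ; leaves = All.tail (Allₚ.++⁻ʳ z₁ lz) ; parent-< = ℓ<v ; label-≤ = v≤ }

  -- With only leaves behind it, a unary new parent is itself the last vertex with children. A leaf
  -- comes after `p` in the word and cannot be smaller, since an inversion starting at `p` would
  -- force `p > k`.
  legal-cases : ∀ {v ℓ b′} → Legal k w v ℓ b′ → (b ≡ true × ℓ ≡ p × b′ ≡ false) ⊎ (p < ℓ × b′ ≡ true)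
  legal-cases l with opens l | split l | parent st
  ... | unary | eq | none lw = contradiction (All.lookup (subst Leaves eq lw) (∈-++⁺ʳ (before l) (here refl))) λ ()
  ... | unary | eq | some u z o lz eq′
    with p≡ , s≡ ← lastInternal-unique u (before l) (internal-not-leaf o) (λ ()) lz (leaves l) (trans (sym eq′) eq) =
    inj₁ (room o s≡ , sym p≡ , refl)
    where
    room : ∀ {s b} → Opens s b → inc s ≡ unary → b ≡ true
    room leaf _ = refl
  ... | leaf | eq | none _ = inj₂ (proj₁ (All.lookup (bounded g) ℓ∈) , refl)
    where
    ℓ∈ : _ ∈ labelsOf w
    ℓ∈ = subst (λ w → _ ∈ labelsOf w) (sym eq) (∈-map⁺ proj₁ (∈-++⁺ʳ (before l) (here refl)))
  ... | leaf | eq | some u z o lz eq′ = inj₂ (≤∧≢⇒< (≮⇒≥ ℓ≮p) (before-≢ (unique g) p-before-ℓ) , refl)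
    where
    p-before-ℓ : Before p _ (labelsOf w)
    p-before-ℓ = subst (Before p _) (cong labelsOf (sym eq′))
      (internal-before-leaf u (before l) (internal-not-leaf o) (leaves l) (trans (sym eq′) eq))
    ℓ≮p : ¬ _ < p
    ℓ≮p ℓ<p = <⇒≱ (last-inversions g st p-before-ℓ ℓ<p) (parent-≤ st)

-- Removing the last vertex

record Shrunk (n : ℕ) (w′ : Word) : Set where
  field
    {w}         : Word
    {k p v ℓ}   : ℕ
    {b b′}      : Bool
    valid       : Valid (suc n) w
    state       : State k p b w
    legal       : Legal k w v ℓ b′
    grow-≡      : grow v ℓ w ≡ w′

-- The last vertex is the last child of `ℓ`, the last vertex with children: deleting it, taking one
-- child from `ℓ` and closing the gap at `v` undoes `grow`.
shrink-last : ∀ {n} u {ℓ s b z v} → Opens s b → Leaves z →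
  Valid (suc (suc n)) ((u ++ (ℓ , inc s) ∷ z) ∷ʳ (v , leaf)) → Shrunk n ((u ++ (ℓ , inc s) ∷ z) ∷ʳ (v , leaf))
shrink-last {n} u {ℓ} {s} {b} {z} {v} o lz g = record
  { valid = valid ; state = state ; legal = legal
  ; grow-≡ = trans (grow-split (map f u) (map f z) (Valid.unique valid) ℓ<v)
      (trans (cong₂ (λ u z → u ++ (ℓ , inc s) ∷ z ∷ʳ (v , leaf)) (relabel-inverse u (v∉ ∘ ∈-u)) (relabel-inverse z (v∉ ∘ ∈-z)))
        (sym (++-assoc u _ _))) }
  where
  f : ℕ × Arity → ℕ × Arity
  f = relabel (unshift v)
  w₀ w₁ w : Word
  w₀ = u ++ (ℓ , inc s) ∷ z
  w₁ = u ++ (ℓ , s) ∷ z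
  w = map f u ++ (ℓ , s) ∷ map f z

  labels-≡ : labelsOf (w₀ ∷ʳ (v , leaf)) ≡ labelsOf w₁ ∷ʳ v
  labels-≡ = trans (labelsOf-∷ʳ w₀) (cong (_∷ʳ v) (labelsOf-resplit u))
  both : Unique (labelsOf w₁) × v ∉ labelsOf w₁
  both = unique-∷ʳ⁻ (subst Unique labels-≡ (unique g))
  v∉ : v ∉ labelsOf w₁
  v∉ = proj₂ both
  ∈-u : ∀ {x} → x ∈ labelsOf u → x ∈ labelsOf w₁
  ∈-u x∈ = subst (_ ∈_) (sym (map-++ proj₁ u _)) (∈-++⁺ˡ x∈)
  ∈-z : ∀ {x} → x ∈ labelsOf z → x ∈ labelsOf w₁
  ∈-z x∈ = subst (_ ∈_) (sym (map-++ proj₁ u _)) (∈-++⁺ʳ (labelsOf u) (there x∈))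

  step : ℓ < v × Increasing (0 ∷ []) w₁
  step = increasing-grow⁻ u o lz (subst (Increasing _) (++-assoc u _ _) (parents-< g))
  ℓ<v : ℓ < v
  ℓ<v = proj₁ step
  0<v : 0 < v
  0<v = ≤-<-trans z≤n ℓ<v

  relabel-inverse : ∀ y → v ∉ labelsOf y → map (relabel (shift v)) (map f y) ≡ y
  relabel-inverse [] _ = refl
  relabel-inverse (_ ∷ y) v∉ = cong₂ _∷_ (cong (_, _) (shift-unshift v (v∉ ∘ here ∘ sym))) (relabel-inverse y (v∉ ∘ there))

  shift-w : map (relabel (shift v)) w ≡ w₁
  shift-w = trans (map-++ _ (map f u) _) (cong₂ _++_ (relabel-inverse u (v∉ ∘ ∈-u))
    (cong₂ _∷_ (cong (_, s) (shift-< ℓ<v)) (relabel-inverse z (v∉ ∘ ∈-z))))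

  shift-labels : map (shift v) (labelsOf w) ≡ labelsOf w₁
  shift-labels = trans (sym (labelsOf-relabel (shift v) w)) (cong labelsOf shift-w)

  labels-bounds : All (λ x → 0 < x × x ≤ suc (suc n)) (labelsOf w₁ ∷ʳ v)
  labels-bounds = subst (All _) labels-≡ (bounded g)

  v≤2+n : v ≤ suc (suc n)
  v≤2+n = proj₂ (proj₂ (Allₚ.∷ʳ⁻ labels-bounds))

  shift-bound : ∀ x → 0 < shift v x × shift v x ≤ suc (suc n) → 0 < x × x ≤ suc n
  shift-bound x (0<sx , sx≤) = shift-cancel-< v (subst (_< shift v x) (sym (shift-< 0<v)) 0<sx) , lower
    where
    lower : x ≤ suc n
    lower with <-cmp x v
    ... | tri< x<v _ _ = s≤s⁻¹ (≤-trans x<v v≤2+n)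
    ... | tri≈ _ refl _ = s≤s⁻¹ (subst (_≤ suc (suc n)) (shift-≥ {v} ≤-refl) sx≤)
    ... | tri> _ _ v<x = s≤s⁻¹ (subst (_≤ suc (suc n)) (shift-≥ (<⇒≤ v<x)) sx≤)

  shift-∈ : ∀ {x} → 0 < x → x ≤ suc n → x ∈ labelsOf w
  shift-∈ {x} 0<x x≤ with ∈-++⁻ (labelsOf w₁) (subst (shift v x ∈_) labels-≡
    (complete g (<-≤-trans 0<x (≤-shift v x)) (≤-trans (shift-≤ v x) (s≤s x≤))))
  ... | inj₂ (here sx≡v) = contradiction sx≡v (shift-≢ v)
  ... | inj₁ sx∈ with y , y∈ , sx≡sy ← ∈-map⁻ (shift v) (subst (shift v x ∈_) (sym shift-labels) sx∈) =
    subst (_∈ labelsOf w) (sym (shift-injective v sx≡sy)) y∈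

  avoids : Avoiding (labelsOf w₁) × (∀ {x y} → Before x y (labelsOf w₁) → y < x → ¬ x < v)
  avoids = avoiding-∷ʳ⁻ _ (subst Avoiding labels-≡ (avoiding g))

  valid : Valid (suc n) w
  valid .length-≡ = suc-injective (trans (trans (cong suc lengths) (+-comm 1 _))
    (trans (sym (length-++ w₀)) (length-≡ g)))
    where
    lengths : length w ≡ length w₀
    lengths = trans (length-++ (map f u)) (trans (cong₂ _+_ (length-map f u) (cong suc (length-map f z))) (sym (length-++ u)))
  valid .bounded = All.map (λ {x} → shift-bound x) (Allₚ.map⁻ {f = shift v} (subst (All _) (sym shift-labels) (proj₁ (Allₚ.∷ʳ⁻ labels-bounds))))
  valid .unique = Uniqueₚ.map⁻ (subst Unique (sym shift-labels) (proj₁ both))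
  valid .complete = shift-∈
  valid .parents-< = increasing-relabel⁻ (shift-cancel-< v) (0 ∷ []) w
    (subst₂ Increasing (cong (_∷ []) (sym (shift-< 0<v))) (sym shift-w) (proj₂ step))
  valid .avoiding = avoiding-map⁻ (shift-mono-< v) _ (subst Avoiding (sym shift-labels) (proj₁ avoids))

  states : ∃₂ λ k p → ∃ λ b → State k p b w
  states = valid-state valid
  k = proj₁ states
  state = proj₂ (proj₂ (proj₂ states))

  -- If `k + 1 < v`, then `k + 1` is a label of the smaller word and precedes its last label `k`.
  -- The shift moves neither, so `k + 1`, `k`, `v` would form 213.
  v≤1+k : v ≤ suc k
  v≤1+k = ≮⇒≥ λ 1+k<v → proj₂ avoids (before-k 1+k<v) (n<1+n k) 1+k<v
    where
    before-k : suc k < v → Before (suc k) k (labelsOf w₁)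
    before-k 1+k<v = subst₂ (λ x y → Before x y (labelsOf w₁)) (shift-< 1+k<v) (shift-< (<-trans (n<1+n k) 1+k<v))
      (subst (Before _ _) shift-labels (before-map⁺ (shift v) (subst (Before (suc k) k) (sym w-labels)
        (before-++ (k ∷ []) (member (∈-++⁻ (labelsOf (init state)) (subst (suc k ∈_) w-labels
          (shift-∈ (s≤s z≤n) (s≤s⁻¹ (≤-trans 1+k<v v≤2+n)))))) (here refl)))))
      where
      w-labels : labelsOf w ≡ labelsOf (init state) ∷ʳ k
      w-labels = trans (cong labelsOf (init∷ʳ state)) (labelsOf-∷ʳ (init state))
      member : ∀ {σ} → suc k ∈ σ ⊎ suc k ∈ (k ∷ []) → suc k ∈ σ
      member (inj₁ x∈) = x∈
      member (inj₂ (here eq)) = contradiction eq (1+n≢n)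

  legal : Legal k w v ℓ b
  legal = record { split = refl ; opens = o ; leaves = leaves-relabel (unshift v) lz ; parent-< = ℓ<v ; label-≤ = v≤1+k }

shrink : ∀ {n w′} → Valid (suc (suc n)) w′ → Shrunk n w′
shrink {w′ = w′} g with initLast w′
shrink g | [] with () ← length-≡ g
shrink g | w₀ ∷ʳ′ (v , s) with refl ← increasing-last w₀ (parents-< g) with lastInternal w₀
... | some u z o lz refl = shrink-last u o lz g
-- If all vertices before the last one were leaves, the queue would be empty right after the root,
-- although the word has at least two letters.
... | none lw = contradiction (parents-< g) (no-increasing w₀ lw (λ { refl → contradiction (length-≡ g) λ () }))
  where
  no-increasing : ∀ w₀ → Leaves w₀ → w₀ ≢ [] → ¬ Increasing (0 ∷ []) (w₀ ∷ʳ (v , leaf))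
  no-increasing [] _ ≢[] _ = ≢[] refl
  no-increasing (_ ∷ []) (refl ∷ _) _ (_ ∷ ())
  no-increasing (_ ∷ _ ∷ _) (refl ∷ _) _ (_ ∷ ())

-- Runs encode valid words

parentOf : ℕ → ℕ → ℕ → ℕ
parentOf p e c = p + (e ∸ c)

decode : ∀ {a b m} → ℕ → Word → Run a b m → Word
decode p w stop = w
decode p w (fresh e _ c _ r) = decode (parentOf p e c) (grow (suc (p + e)) (parentOf p e c) w) r
decode p w (same i _ r)      = decode p (grow (suc (p + i)) p w) r

parentOf-label : ∀ p {e c} → c < e → parentOf p e c + suc c ≡ suc (p + e)
parentOf-label p {e} {c} c<e = trans (+-suc _ c) (cong suc
  (trans (+-assoc p (e ∸ c) c) (cong (_+_ p) (m∸n+n≡m (<⇒≤ c<e)))))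

module _ {n p a b w} (g : Valid n w) (st : State (p + a) p b w) where

  fresh-legal : ∀ {e c} → e < suc a → c < e → Legal (p + a) w (suc (p + e)) (parentOf p e c) true
  fresh-legal {e} {c} e≤a c<e = legal-fresh g st
    (m<m+n p (m<n⇒0<n∸m c<e)) (s≤s (+-monoʳ-≤ p (m∸n≤m e c))) (s≤s (+-monoʳ-≤ p (s≤s⁻¹ e≤a)))

  fresh-state : ∀ {e c} → e < suc a → c < e → State (parentOf p e c + suc c) (parentOf p e c) true (grow (suc (p + e)) (parentOf p e c) w)
  fresh-state {e} {c} e≤a c<e rewrite parentOf-label p c<e = grow-state g st (fresh-legal e≤a c<e)

  same-state : ∀ {i} → b ≡ true → i < suc a → State (p + suc i) p false (grow (suc (p + i)) p w)
  same-state {i} b≡ i≤a rewrite +-suc p i =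
    grow-state g st (legal-same g st b≡ (s≤s (m≤m+n p i)) (s≤s (+-monoʳ-≤ p (s≤s⁻¹ i≤a))))

  same-valid : ∀ {i} → b ≡ true → i < suc a → Valid (suc n) (grow (suc (p + i)) p w)
  same-valid {i} b≡ i≤a =
    grow-valid g st (legal-same g st b≡ (s≤s (m≤m+n p i)) (s≤s (+-monoʳ-≤ p (s≤s⁻¹ i≤a))))

decode-valid : ∀ {m n p a b w} → Valid n w → State (p + a) p b w → (r : Run a b m) → Valid (m + n) (decode p w r)
decode-valid g st stop = g
decode-valid {suc m} {n} {w = w} g st (fresh e p c q r) rewrite sym (+-suc m n) =
  decode-valid (grow-valid g st (fresh-legal g st p q)) (fresh-state g st p q) r
decode-valid {suc m} {n} g st (same i p r) rewrite sym (+-suc m n) =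
  decode-valid (same-valid g st refl p) (same-state g st refl p) r

SomeRun : ℕ → Set
SomeRun m = ∃₂ λ a b → Run a b m

-- Both starting words are arbitrary, because the recursion passes to grown words. The recursive
-- call identifies these words and their parent labels, after which `grow-injective` recovers the
-- words before the step. A fresh and a same step cannot meet, as they leave different flags.
decode-injective : ∀ {m n p p′ a a′ b b′ w w′} →
  Valid n w → State (p + a) p b w → Valid n w′ → State (p′ + a′) p′ b′ w′ →
  (r : Run a b m) (r′ : Run a′ b′ m) → decode p w r ≡ decode p′ w′ r′ →
  w ≡ w′ × p ≡ p′ × _≡_ {A = SomeRun m} (a , b , r) (a′ , b′ , r′)
decode-injective {p = p} {a = a} {a′} g st g′ st′ stop stop refl with k≡ , refl , refl ← state-unique st st′
  with refl ← +-cancelˡ-≡ p a a′ k≡ = refl , refl , refl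
decode-injective {p = p} {a = a} {a′} {w = w} {w′} g st g′ st′ (fresh e e≤ c c< r) (fresh e′ e≤′ c′ c<′ r′) eq
  with decode-injective (grow-valid g st (fresh-legal g st e≤ c<)) (fresh-state g st e≤ c<)
                        (grow-valid g′ st′ (fresh-legal g′ st′ e≤′ c<′)) (fresh-state g′ st′ e≤′ c<′) r r′ eq
... | grow≡ , p≡ , refl rewrite p≡ with v≡ , refl ← grow-injective w w′ grow≡
  with k≡ , refl , refl ← state-unique st st′
  with refl ← +-cancelˡ-≡ p a a′ k≡ | refl ← +-cancelˡ-≡ p e e′ (suc-injective v≡)
  with refl ← <-irrelevant e≤ e≤′ | refl ← <-irrelevant c< c<′ = refl , refl , refl
decode-injective {p = p} {a = a} {a′} {w = w} {w′} g st g′ st′ (same i i≤ r) (same i′ i≤′ r′) eq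
  with decode-injective (same-valid g st refl i≤) (same-state g st refl i≤)
                        (same-valid g′ st′ refl i≤′) (same-state g′ st′ refl i≤′) r r′ eq
... | grow≡ , refl , refl with v≡ , refl ← grow-injective w w′ grow≡
  with k≡ , _ , _ ← state-unique st st′
  with refl ← +-cancelˡ-≡ p a a′ k≡ with refl ← <-irrelevant i≤ i≤′ = refl , refl , refl
decode-injective g st g′ st′ (fresh e e≤ c c< r) (same i′ i≤′ r′) eq
  with decode-injective (grow-valid g st (fresh-legal g st e≤ c<)) (fresh-state g st e≤ c<)
                        (same-valid g′ st′ refl i≤′) (same-state g′ st′ refl i≤′) r r′ eq
... | _ , _ , ()
decode-injective g st g′ st′ (same i i≤ r) (fresh e′ e≤′ c′ c<′ r′) eq
  with decode-injective (same-valid g st refl i≤) (same-state g st refl i≤)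
                        (grow-valid g′ st′ (fresh-legal g′ st′ e≤′ c<′)) (fresh-state g′ st′ e≤′ c<′) r r′ eq
... | _ , _ , ()

record Decoded (m n : ℕ) (w′ : Word) : Set where
  field
    {w}      : Word
    {p a}    : ℕ
    {b}      : Bool
    valid    : Valid n w
    state    : State (p + a) p b w
    run      : Run a b m
    decode-≡ : decode p w run ≡ w′

-- The coordinates of a fresh step: `e` measures the new label from `p`, and `c` measures the
-- distance from its parent up to it, each less one.
split-label : ∀ {p ℓ v k} → p < ℓ → ℓ < v → v ≤ suc k →
  ∃₂ λ e c → p + e ≤ k × c < e × v ≡ suc (p + e) × ℓ ≡ parentOf p e c
split-label {p} {ℓ} {suc v} p<ℓ (s≤s ℓ≤v) (s≤s v≤k) =
  v ∸ p , v ∸ ℓ , subst (_≤ _) (sym p+) v≤k , ∸-monoʳ-< p<ℓ ℓ≤v , cong suc (sym p+) , ℓ≡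
  where
  p≤v = ≤-trans (<⇒≤ p<ℓ) ℓ≤v
  p+ : p + (v ∸ p) ≡ v
  p+ = m+[n∸m]≡n p≤v
  ℓ≡ : ℓ ≡ p + (v ∸ p ∸ (v ∸ ℓ))
  ℓ≡ = begin
    ℓ                     ≡⟨ m∸[m∸n]≡n ℓ≤v ⟨
    v ∸ (v ∸ ℓ)           ≡⟨ cong (_∸ (v ∸ ℓ)) p+ ⟨
    p + (v ∸ p) ∸ (v ∸ ℓ) ≡⟨ +-∸-assoc p (∸-monoʳ-≤ v (<⇒≤ p<ℓ)) ⟩
    p + (v ∸ p ∸ (v ∸ ℓ)) ∎
    where open ≡-Reasoning

-- `legal-cases` selects the constructor, and `state-unique` shows that the given run starts in the
-- very state which this step produces.
prepend : ∀ {m n w₁ w′ a₁ p₁ b₁ k p v ℓ b b₀} {w : Word} → Valid (suc n) w → State k p b₀ w → Legal k w v ℓ b →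
  grow v ℓ w ≡ w₁ → State (p₁ + a₁) p₁ b₁ w₁ → (r : Run a₁ b₁ m) → decode p₁ w₁ r ≡ w′ → Decoded (suc m) (suc n) w′
prepend {k = k} {p} g st l refl st₁ r eq with legal-cases g st l
prepend {a₁ = a₁} {p = p} {v = suc v} {b₀ = true} g st l refl st₁ r eq | inj₁ (refl , refl , refl)
  with i , refl ← m≤n⇒∃[o]m+o≡n (s≤s⁻¹ (parent-< l)) | a , refl ← m≤n⇒∃[o]m+o≡n (parent-≤ st)
  with k≡ , refl , refl ← state-unique st₁ (grow-state g st l)
  with refl ← +-cancelˡ-≡ p a₁ (suc i) (trans k≡ (sym (+-suc p i))) =
  record { valid = g ; state = st ; run = same i (s≤s (+-cancelˡ-≤ p i a (s≤s⁻¹ (label-≤ l)))) r ; decode-≡ = eq }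
prepend {a₁ = a₁} {p = p} g st l refl st₁ r eq | inj₂ (p<ℓ , refl)
  with e , c , e≤ , c<e , refl , refl ← split-label p<ℓ (parent-< l) (label-≤ l) | a , refl ← m≤n⇒∃[o]m+o≡n (parent-≤ st)
  with k≡ , refl , refl ← state-unique st₁ (grow-state g st l)
  with refl ← +-cancelˡ-≡ (parentOf p e c) a₁ (suc c) (trans k≡ (sym (parentOf-label p c<e))) =
  record { valid = g ; state = st ; run = fresh e (s≤s (+-cancelˡ-≤ p e a e≤)) c c<e r ; decode-≡ = eq }

-- A run of length `m` from a word with one more vertex is found first; shrinking that word then
-- supplies the step in front.
decode-surjective : ∀ m n {w′} → Valid (suc (m + n)) w′ → Decoded m (suc n) w′
decode-surjective zero n g with k , p , b , st ← valid-state g with a , refl ← m≤n⇒∃[o]m+o≡n (parent-≤ st) =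
  record { valid = g ; state = st ; run = stop ; decode-≡ = refl }
decode-surjective (suc m) n {w′} g
  with d ← decode-surjective m (suc n) (subst (λ l → Valid (suc l) w′) (sym (+-suc m n)) g)
  with s ← shrink (Decoded.valid d) =
  prepend (Shrunk.valid s) (Shrunk.state s) (Shrunk.legal s) (Shrunk.grow-≡ s) (Decoded.state d) (Decoded.run d) (Decoded.decode-≡ d)

root : Word
root = (1 , leaf) ∷ []

root-valid : Valid 1 root
root-valid = record
  { length-≡ = refl ; bounded = (s≤s z≤n , s≤s z≤n) ∷ [] ; unique = [] ∷ []
  ; complete = λ 0<x x≤1 → here (≤-antisym x≤1 0<x)
  ; parents-< = s≤s z≤n ∷ [] ; avoiding = (λ ()) , _ }

root-state : State (0 + 1) 0 false root
root-state = record { parent = none (refl ∷ []) ; init = [] ; init∷ʳ = refl ; parent-≤ = z≤n }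

valid-1 : ∀ {w} → Valid 1 w → w ≡ root
valid-1 {[]} g with () ← length-≡ g
valid-1 {_ ∷ _ ∷ _} g with () ← length-≡ g
valid-1 {(x , s) ∷ []} g with refl ← increasing-last [] (parents-< g) | (0<x , x≤1) ∷ [] ← bounded g
  with refl ← ≤-antisym x≤1 0<x = refl

wordOf : ∀ {m} → Run 1 false m → Word
wordOf = decode 0 root

wordOf-valid : ∀ {m} (r : Run 1 false m) → Valid (suc m) (wordOf r)
wordOf-valid {m} r = subst (λ n → Valid n (wordOf r)) (+-comm m 1) (decode-valid root-valid root-state r)

wordOf-injective : ∀ {m} (r r′ : Run 1 false m) → wordOf r ≡ wordOf r′ → r ≡ r′
wordOf-injective r r′ eq with _ , _ , refl ← decode-injective root-valid root-state root-valid root-state r r′ eq = refl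

wordOf-surjective : ∀ {m w} → Valid (suc m) w → ∃ λ (r : Run 1 false m) → wordOf r ≡ w
wordOf-surjective {m} {w} g with d ← decode-surjective m 0 (subst (λ n → Valid (suc n) w) (sym (+-identityʳ m)) g) = go d
  where
  go : ∀ {w′} → Decoded m 1 w′ → ∃ λ (r : Run 1 false m) → wordOf r ≡ w′
  go record { valid = g ; state = st ; run = r ; decode-≡ = eq } with refl ← valid-1 g
    with k≡ , refl , refl ← state-unique st root-state with refl ← k≡ = r , eq

-- Breadth-first traversal of forests

arity : UBTree → Arity
arity (node0 _)     = leaf
arity (node1 _ _)   = unary
arity (node2 _ _ _) = binary

subtrees : UBTree → List UBTree
subtrees (node0 _)     = []
subtrees (node1 _ t)   = t ∷ []
subtrees (node2 _ t u) = t ∷ u ∷ []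

-- The forest is the queue of a breadth-first traversal, and the word is what the traversal reads.
data Reads : List UBTree → Word → Set where
  []  : Reads [] []
  _∷_ : ∀ t {ts w} → Reads (ts ++ subtrees t) w → Reads (t ∷ ts) ((label t , arity t) ∷ w)

total : List UBTree → ℕ
total ts = sum (map size ts)

total-++ : ∀ ts us → total (ts ++ us) ≡ total ts + total us
total-++ ts us = trans (cong sum (map-++ size ts us)) (sum-++ (map size ts) _)

size-subtrees : ∀ t → size t ≡ suc (total (subtrees t))
size-subtrees (node0 _)     = refl
size-subtrees (node1 _ t)   = cong suc (sym (+-identityʳ (size t)))
size-subtrees (node2 _ t u) = cong (λ s → suc (size t + s)) (sym (+-identityʳ (size u)))

-- The recursion is on the bound `n` for the number of vertices left, since the queue itself may
-- become longer.
read : ∀ n ts → total ts ≤ n → ∃ λ w → Reads ts w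
read n [] _ = [] , []
read zero (t ∷ ts) le with () ← subst (λ s → s + total ts ≤ 0) (size-subtrees t) le
read (suc n) (t ∷ ts) le with w , r ← read n (ts ++ subtrees t) (subst (_≤ n)
  (trans (+-comm (total (subtrees t)) (total ts)) (sym (total-++ ts (subtrees t))))
  (s≤s⁻¹ (subst (λ s → s + total ts ≤ suc n) (size-subtrees t) le))) = _ , t ∷ r

reads-functional : ∀ {ts w w′} → Reads ts w → Reads ts w′ → w ≡ w′
reads-functional []      []       = refl
reads-functional (t ∷ r) (_ ∷ r′) = cong (_ ∷_) (reads-functional r r′)

-- The forest is recovered from the end of the word: each arity tells how many trees to take from
-- the back of the queue as children.
reads-injective : ∀ {ts ts′ w w′} → Reads ts w → Reads ts′ w′ → w ≡ w′ → ts ≡ ts′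
reads-injective [] [] _ = refl
reads-injective (node0 x ∷ r) (node0 x′ ∷ r′) refl =
  cong (node0 x ∷_) (trans (sym (++-identityʳ _)) (trans (reads-injective r r′ refl) (++-identityʳ _)))
reads-injective (node1 x t ∷ r) (node1 x′ t′ ∷ r′) refl
  with refl , refl ← ∷ʳ-injective _ _ (reads-injective r r′ refl) = refl
reads-injective (_∷_ (node2 x t u) {ts} r) (_∷_ (node2 x′ t′ u′) {ts′} r′) refl
  with eq , refl ← ∷ʳ-injective (ts ∷ʳ t) (ts′ ∷ʳ t′)
         (trans (++-assoc ts _ _) (trans (reads-injective r r′ refl) (sym (++-assoc ts′ _ _))))
  with refl , refl ← ∷ʳ-injective ts ts′ eq = refl
reads-injective (node0 _ ∷ _) (node1 _ _ ∷ _) ()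
reads-injective (node0 _ ∷ _) (node2 _ _ _ ∷ _) ()
reads-injective (node1 _ _ ∷ _) (node0 _ ∷ _) ()
reads-injective (node1 _ _ ∷ _) (node2 _ _ _ ∷ _) ()
reads-injective (node2 _ _ _ ∷ _) (node0 _ ∷ _) ()
reads-injective (node2 _ _ _ ∷ _) (node1 _ _ ∷ _) ()

unsnoc : ∀ {A : Set} {n} (xs : List A) → length xs ≡ suc n → ∃₂ λ ys y → xs ≡ ys ∷ʳ y × length ys ≡ n
unsnoc xs eq with initLast xs
unsnoc .(ys ∷ʳ y) eq | ys ∷ʳ′ y = ys , y , refl , suc-injective (trans (+-comm 1 _) (trans (sym (length-++ ys)) eq))

-- The trees are built from the end of the word. The equality of lengths guarantees that the back of
-- the forest holds as many trees as the arity demands.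
unread : ∀ {ps w} → Increasing ps w → ∃ λ ts → Reads ts w × length ts ≡ length ps
unread [] = [] , [] , refl
unread {_ ∷ ps} {(x , leaf) ∷ w} (_ ∷ i) with ts , r , eq ← unread i =
  node0 x ∷ ts , node0 x ∷ subst (λ ts → Reads ts w) (sym (++-identityʳ ts)) r ,
  cong suc (trans eq (cong length (++-identityʳ ps)))
unread {_ ∷ ps} {(x , unary) ∷ w} (_ ∷ i) with ts , r , eq ← unread i
  with ts₀ , t , refl , eq₀ ← unsnoc ts (trans eq (trans (length-++ ps) (+-comm _ 1))) =
  node1 x t ∷ ts₀ , node1 x t ∷ r , cong suc eq₀
unread {_ ∷ ps} {(x , binary) ∷ w} (_ ∷ i) with ts , r , eq ← unread i
  with ts₁ , u , refl , eq₁ ← unsnoc ts (trans eq (trans (length-++ ps) (+-comm _ 2)))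
  with ts₀ , t , refl , eq₀ ← unsnoc ts₁ eq₁ =
  node2 x t u ∷ ts₀ , node2 x t u ∷ subst (λ ts → Reads ts w) (++-assoc ts₀ _ _) r , cong suc eq₀

-- Increasing trees and increasing words

Above : ℕ → UBTree → Set
Above y t = y < label t × T (increasing t)

above-subtrees⁺ : ∀ t → T (increasing t) → Pointwise Above (kids (label t) (arity t)) (subtrees t)
above-subtrees⁺ (node0 x)     _  = []
above-subtrees⁺ (node1 x t)   it with p , q ← to T-∧ it = (<ᵇ⇒< x _ p , q) ∷ []
above-subtrees⁺ (node2 x t u) it with p , q ← to (T-∧ {x <ᵇ label t}) it with p′ , q′ ← to (T-∧ {x <ᵇ label u}) q
  with i , j ← to (T-∧ {increasing t}) q′ = (<ᵇ⇒< x _ p , i) ∷ (<ᵇ⇒< x _ p′ , j) ∷ []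

above-subtrees⁻ : ∀ t → Pointwise Above (kids (label t) (arity t)) (subtrees t) → T (increasing t)
above-subtrees⁻ (node0 x)     _ = _
above-subtrees⁻ (node1 x t)   ((p , q) ∷ []) = from T-∧ (<⇒<ᵇ p , q)
above-subtrees⁻ (node2 x t u) ((p , i) ∷ (p′ , j) ∷ []) =
  from T-∧ (<⇒<ᵇ p , from T-∧ (<⇒<ᵇ p′ , from T-∧ (i , j)))

reads-increasing⁺ : ∀ {ps ts w} → Reads ts w → Pointwise Above ps ts → Increasing ps w
reads-increasing⁺ [] [] = []
reads-increasing⁺ (t ∷ r) ((y<x , it) ∷ as) = y<x ∷ reads-increasing⁺ r (Pointwise.++⁺ as (above-subtrees⁺ t it))

kids-length : ∀ t → length (kids (label t) (arity t)) ≡ length (subtrees t)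
kids-length (node0 _)     = refl
kids-length (node1 _ _)   = refl
kids-length (node2 _ _ _) = refl

pointwise-++⁻ : ∀ {ps qs ts us} → length ps ≡ length ts → Pointwise Above (ps ++ qs) (ts ++ us) →
  Pointwise Above ps ts × Pointwise Above qs us
pointwise-++⁻ {[]}     {ts = []}     _  as       = [] , as
pointwise-++⁻ {_ ∷ ps} {ts = _ ∷ ts} eq (a ∷ as) with bs , cs ← pointwise-++⁻ {ps} {ts = ts} (suc-injective eq) as = a ∷ bs , cs

reads-increasing⁻ : ∀ {ps ts w} → Reads ts w → Increasing ps w → Pointwise Above ps ts
reads-increasing⁻ [] [] = []
reads-increasing⁻ {y ∷ ps} (_∷_ t {ts} r) (y<x ∷ i) with as ← reads-increasing⁻ r i
  -- The longer queues have equal lengths and received equally many children, so the relation splits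
  -- where the original queues end.
  with bs , cs ← pointwise-++⁻ {ps} {ts = ts} (+-cancelʳ-≡ (length (subtrees t)) _ _ (trans
         (cong (_+_ (length ps)) (sym (kids-length t)))
         (trans (sym (length-++ ps)) (trans (Pointwise.Pointwise-length as) (length-++ ts))))) as =
  (y<x , above-subtrees⁻ t cs) ∷ bs

-- Labels, sizes and generations along the traversal

labels-subtrees : ∀ t → labels t ≡ label t ∷ concatMap labels (subtrees t)
labels-subtrees (node0 _)     = refl
labels-subtrees (node1 x t)   = cong (x ∷_) (sym (++-identityʳ (labels t)))
labels-subtrees (node2 x t u) = cong (λ σ → x ∷ labels t ++ σ) (sym (++-identityʳ (labels u)))

reads-labels : ∀ {ts w} → Reads ts w → labelsOf w ↭ concatMap labels ts
reads-labels [] = ↭-refl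
reads-labels (_∷_ t {ts} r) = ↭-trans (prep (label t) (↭-trans (reads-labels r) (↭-trans
  (↭-reflexive (concatMap-++ labels ts (subtrees t))) (↭-++-comm (concatMap labels ts) _))))
  (↭-reflexive (cong (_++ concatMap labels ts) (sym (labels-subtrees t))))

reads-length : ∀ {ts w} → Reads ts w → length w ≡ total ts
reads-length [] = refl
reads-length (_∷_ t {ts} r) = trans (cong suc (trans (reads-length r) (trans (total-++ ts (subtrees t)) (+-comm (total ts) _))))
  (cong (_+ total ts) (sym (size-subtrees t)))

-- Once the trees `ts` at the front have been read, the queue holds `us` followed by the children of
-- `ts`: traversing one level leaves the next.
reads-level : ∀ ts us {w} → Reads (ts ++ us) w →
  ∃ λ w′ → labelsOf w ≡ map label ts ++ labelsOf w′ × Reads (us ++ concatMap subtrees ts) w′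
reads-level [] us r = _ , refl , subst (λ ts → Reads ts _) (sym (++-identityʳ us)) r
reads-level (t ∷ ts) us (_ ∷ r)
  with w′ , eq , r′ ← reads-level ts (us ++ subtrees t) (subst (λ ts → Reads ts _) (++-assoc ts us (subtrees t)) r) =
  w′ , cong (label t ∷_) eq , subst (λ ts → Reads ts _) (++-assoc us (subtrees t) _) r′

generation-suc : ∀ d t → generation (suc d) t ≡ concatMap (generation d) (subtrees t)
generation-suc d (node0 _)     = refl
generation-suc d (node1 _ t)   = sym (++-identityʳ (generation d t))
generation-suc d (node2 _ t u) = cong (generation d t ++_) (sym (++-identityʳ (generation d u)))

generations-zero : ∀ ts → concatMap (generation 0) ts ≡ map label ts
generations-zero []       = refl
generations-zero (t ∷ ts) = cong (label t ∷_) (generations-zero ts)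

generations-suc : ∀ d ts → concatMap (generation (suc d)) ts ≡ concatMap (generation d) (concatMap subtrees ts)
generations-suc d []       = refl
generations-suc d (t ∷ ts) = trans (cong₂ _++_ (generation-suc d t) (generations-suc d ts))
  (sym (concatMap-++ (generation d) (subtrees t) _))

total-level : ∀ ts → length ts + total (concatMap subtrees ts) ≡ total ts
total-level [] = refl
total-level (t ∷ ts) = begin
  suc (length ts + total (subtrees t ++ us))            ≡⟨ cong (λ s → suc (length ts + s)) (total-++ (subtrees t) us) ⟩
  suc (length ts + (total (subtrees t) + total us))     ≡⟨ cong suc (m+[n+o]≡n+[m+o] (length ts) (total (subtrees t)) (total us)) ⟩
  suc (total (subtrees t)) + (length ts + total us)     ≡⟨ cong₂ _+_ (sym (size-subtrees t)) (total-level ts) ⟩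
  size t + total ts                                     ∎
  where
  open ≡-Reasoning
  us = concatMap subtrees ts
  m+[n+o]≡n+[m+o] : ∀ m n o → m + (n + o) ≡ n + (m + o)
  m+[n+o]≡n+[m+o] m n o = trans (sym (+-assoc m n o)) (trans (cong (_+ o) (+-comm m n)) (+-assoc n m o))

-- `g` carries the depth offset, because `applyUpTo g` unfolds to `g 0` followed by the values of
-- `g ∘ suc`. Every nonempty level uses up a vertex, so `n` levels suffice and any further ones are
-- empty.
reads-generations : ∀ n (h : ℕ → List ℕ) (g : ℕ → ℕ) ts {w} → Reads ts w → total ts ≤ n →
  (∀ d → h (g d) ≡ concatMap (generation d) ts) → labelsOf w ≡ concatMap h (applyUpTo g n)
reads-generations zero h g [] [] _ _ = refl
reads-generations zero h g (t ∷ ts) _ le _ with () ← subst (λ s → s + total ts ≤ 0) (size-subtrees t) le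
reads-generations (suc n) h g ts r le h≡
  with w′ , eq , r′ ← reads-level ts [] (subst (λ ts → Reads ts _) (sym (++-identityʳ ts)) r) =
  trans eq (cong₂ _++_ (trans (sym (generations-zero ts)) (sym (h≡ 0)))
    (reads-generations n h (g ∘ suc) _ r′ (smaller ts le) λ d → trans (h≡ (suc d)) (generations-suc d ts)))
  where
  smaller : ∀ ts → total ts ≤ suc n → total (concatMap subtrees ts) ≤ n
  smaller []       le = z≤n
  smaller (t ∷ ts) le = s≤s⁻¹ (≤-trans (s≤s (m≤n+m _ (length ts))) (subst (_≤ suc n) (sym (total-level (t ∷ ts))) le))

reads-bfs : ∀ {t w} → Reads (t ∷ []) w → labelsOf w ≡ bfs t
reads-bfs {t} r = reads-generations (size t) (λ d → generation d t) id (t ∷ []) r (≤-reflexive (+-identityʳ (size t)))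
  (λ d → sym (++-identityʳ (generation d t)))

-- The Boolean tests and their propositional forms

has13After⁻ : ∀ x σ → T (has13After x σ) → ∃₂ λ y z → Before y z σ × y < x × x < z
has13After⁻ x (y ∷ σ) h with to (T-∨ {(y <ᵇ x) ∧ any (λ z → x <ᵇ z) σ}) h
... | inj₂ h′ with y′ , z , b , p , q ← has13After⁻ x σ h′ = y′ , z , there b , p , q
... | inj₁ h′ with p , q ← to (T-∧ {y <ᵇ x}) h′ = y , larger (Anyₚ.any⁻ _ σ q)
  where
  larger : Any (λ z → T (x <ᵇ z)) σ → ∃ λ z → Before y z (y ∷ σ) × y < x × x < z
  larger a with z , z∈ , x<z ← find a = z , here z∈ , <ᵇ⇒< y x p , <ᵇ⇒< x z x<z

has13After⁺ : ∀ x σ {y z} → Before y z σ → y < x → x < z → T (has13After x σ)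
has13After⁺ x (y ∷ σ) (here z∈) p q = from T-∨ (inj₁ (from T-∧
  (<⇒<ᵇ p , Anyₚ.any⁺ (λ z → x <ᵇ z) (lose z∈ (<⇒<ᵇ q)))))
has13After⁺ x (y ∷ σ) (there b) p q = from (T-∨ {(y <ᵇ x) ∧ _}) (inj₂ (has13After⁺ x σ b p q))

T-not⁺ : ∀ {b} → ¬ T b → T (not b)
T-not⁺ {false} _  = _
T-not⁺ {true}  ¬t = ¬t _

T-not⁻ : ∀ {b} → T (not b) → ¬ T b
T-not⁻ {false} _ ()

avoids213⁻ : ∀ σ → Avoids213 σ → Avoiding σ
avoids213⁻ [] _ = _
avoids213⁻ (x ∷ σ) av with p , q ← to (T-∧ {not (has13After x σ)}) av =
  (λ b y<x x<z → T-not⁻ p (has13After⁺ x σ b y<x x<z)) , avoids213⁻ σ q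

avoids213⁺ : ∀ σ → Avoiding σ → Avoids213 σ
avoids213⁺ [] _ = _
avoids213⁺ (x ∷ σ) (av , avs) = from T-∧
  (T-not⁺ (λ h → let _ , _ , b , p , q = has13After⁻ x σ h in av b p q) , avoids213⁺ σ avs)

labelsAreOneToN⁻ : ∀ t → T (labelsAreOneToN t) → ∀ {k} → 0 < k → k ≤ size t → k ∈ labels t
labelsAreOneToN⁻ t h {suc k} _ k≤ = Any.map (λ {l} e → sym (≡ᵇ⇒≡ l (suc k) e)) (Anyₚ.any⁻ _ (labels t)
  (All.lookup (Allₚ.all⁺ _ _ h) (∈-map⁺ suc (∈-upTo⁺ k≤))))

labelsAreOneToN⁺ : ∀ t → (∀ {k} → 0 < k → k ≤ size t → k ∈ labels t) → T (labelsAreOneToN t)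
labelsAreOneToN⁺ t complete = Allₚ.all⁻ _ (All.tabulate λ k∈ → member (∈-map⁻ suc k∈))
  where
  member : ∀ {k} → (∃ λ i → i ∈ upTo (size t) × k ≡ suc i) → T (any (λ l → l ≡ᵇ k) (labels t))
  member (i , i∈ , refl) = Anyₚ.any⁺ _ (Any.map (λ {l} e → ≡⇒≡ᵇ l (suc i) (sym e)) (complete (s≤s z≤n) (∈-upTo⁻ i∈)))

unique-resp-↭ : ∀ {σ τ : List ℕ} → σ ↭ τ → Unique σ → Unique τ
unique-resp-↭ p = Permutationₛ.Unique-resp-↭ (setoid ℕ) (↭⇒↭ₛ p)

∈-tail : ∀ {x y : ℕ} {τ} → x ≢ y → x ∈ y ∷ τ → x ∈ τ
∈-tail x≢ (here eq)  = contradiction eq x≢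
∈-tail x≢ (there x∈) = x∈

-- Pigeonhole principle: taking out one occurrence of the largest value leaves a list of length
-- `n − 1` that still contains all smaller values, so neither repetitions nor foreign entries fit
-- in.
complete⇒permutation : ∀ n σ → length σ ≡ n → (∀ {x} → 0 < x → x ≤ n → x ∈ σ) →
  All (λ x → 0 < x × x ≤ n) σ × Unique σ
complete⇒permutation zero [] _ _ = [] , []
complete⇒permutation (suc n) σ len complete with u , z , refl ← ∈-∃++ (complete (s≤s z≤n) ≤-refl)
  with bs , uq ← complete⇒permutation n (u ++ z)
         (suc-injective (trans (↭-length (↭-sym (↭-shift (suc n) u z))) len))
         (λ 0<x x≤n → ∈-tail (<⇒≢ (s≤s x≤n)) (∈-resp-↭ (↭-shift (suc n) u z) (complete 0<x (m≤n⇒m≤1+n x≤n)))) =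
  All-resp-↭ (↭-sym (↭-shift (suc n) u z)) ((s≤s z≤n , ≤-refl) ∷ All.map (λ (p , q) → p , m≤n⇒m≤1+n q) bs) ,
  unique-resp-↭ (↭-sym (↭-shift (suc n) u z)) (All.map (λ (_ , x≤n) eq → 1+n≰n (subst (_≤ n) (sym eq) x≤n)) bs ∷ uq)

-- The bijection between runs and trees

module _ {t w} (r : Reads (t ∷ []) w) where

  tree-labels : labelsOf w ↭ labels t
  tree-labels = ↭-trans (reads-labels r) (↭-reflexive (++-identityʳ (labels t)))

  tree-size : length w ≡ size t
  tree-size = trans (reads-length r) (+-identityʳ (size t))

  tree-valid⁺ : ∀ {n} → IncreasingUBTree n t × Avoids213 (bfs t) → Valid n w
  tree-valid⁺ {n} (it , av) with p , q ← to (T-∧ {size t ≡ᵇ n}) it with l , i ← to (T-∧ {labelsAreOneToN t}) q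
    with refl ← ≡ᵇ⇒≡ (size t) n p = record
    { length-≡ = tree-size ; bounded = proj₁ permutation ; unique = proj₂ permutation ; complete = complete′
    ; parents-< = reads-increasing⁺ r ((proj₁ (All.lookup (proj₁ permutation) (root∈ r)) , i) ∷ [])
    ; avoiding = subst Avoiding (sym (reads-bfs r)) (avoids213⁻ (bfs t) av) }
    where
    complete′ : ∀ {x} → 0 < x → x ≤ size t → x ∈ labelsOf w
    complete′ 0<x x≤ = ∈-resp-↭ (↭-sym tree-labels) (labelsAreOneToN⁻ t l 0<x x≤)
    permutation = complete⇒permutation (size t) (labelsOf w) (trans (length-map proj₁ w) tree-size) complete′
    root∈ : ∀ {w} → Reads (t ∷ []) w → label t ∈ labelsOf w
    root∈ (_ ∷ _) = here refl

  tree-valid⁻ : ∀ {n} → Valid n w → IncreasingUBTree n t × Avoids213 (bfs t)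
  tree-valid⁻ {n} g with (_ , i) ∷ [] ← reads-increasing⁻ r (parents-< g) =
    from T-∧ (≡⇒≡ᵇ (size t) n size≡ , from T-∧
      (labelsAreOneToN⁺ t (λ 0<k k≤ → ∈-resp-↭ tree-labels (complete g 0<k (subst (_ ≤_) size≡ k≤))) , i)) ,
    avoids213⁺ (bfs t) (subst Avoiding (reads-bfs r) (avoiding g))
    where
    size≡ : size t ≡ n
    size≡ = trans (sym tree-size) (length-≡ g)

treeOf : ∀ {n w} → Valid n w → ∃ λ t → Reads (t ∷ []) w
treeOf g with t ∷ [] , r , _ ← unread (parents-< g) = t , r

incTree-≡ : ∀ {n} {t t′ : IncTree213 n} → proj₁ t ≡ proj₁ t′ → t ≡ t′
incTree-≡ {t = t , p , q} {.t , p′ , q′} refl = cong₂ (λ p q → t , p , q) (T-irrelevant p p′) (T-irrelevant q q′)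

run↔tree : ∀ m → Run 1 false m ↔ IncTree213 (suc m)
run↔tree m = mk↔ₛ′ tree run tree-run run-tree
  where
  readable : (r : Run 1 false m) → ∃ λ t → Reads (t ∷ []) (wordOf r)
  readable r = treeOf (wordOf-valid r)
  tree : Run 1 false m → IncTree213 (suc m)
  tree r = proj₁ (readable r) , tree-valid⁻ (proj₂ (readable r)) (wordOf-valid r)
  reading : (t : IncTree213 (suc m)) → ∃ λ w → Reads (proj₁ t ∷ []) w
  reading (t , _) = read _ (t ∷ []) ≤-refl
  decoded : (t : IncTree213 (suc m)) → ∃ λ r → wordOf r ≡ proj₁ (reading t)
  decoded t = wordOf-surjective (tree-valid⁺ (proj₂ (reading t)) (proj₂ t))
  run : IncTree213 (suc m) → Run 1 false m
  run t = proj₁ (decoded t)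
  tree-run : ∀ t → tree (run t) ≡ t
  tree-run t = incTree-≡ (proj₁ (∷-injective
    (reads-injective (proj₂ (readable (run t))) (proj₂ (reading t)) (proj₂ (decoded t)))))
  run-tree : ∀ r → run (tree r) ≡ r
  run-tree r = wordOf-injective _ r (trans (proj₂ (decoded (tree r)))
    (reads-functional (proj₂ (reading (tree r))) (proj₂ (readable r))))

-- For `n = 0` both sides vanish. Otherwise the root is given, and a run of `m` steps from the state
-- `(1 , false)` adds the remaining vertices.
size-incTree : ∀ n → Size (IncTree213 n) (walkCount 0 n)
size-incTree zero    = size-empty λ { (node0 _ , () , _) ; (node1 _ _ , () , _) ; (node2 _ _ _ , () , _) }
size-incTree (suc m) = ↔-trans (↔-sym (run↔tree m)) (subst (Size _) (sym (walkCount≡runCount m)) (size-run m 1 false))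

theorem1 : (n : ℕ) → BasketballExcursion n ↔ IncTree213 n
theorem1 n = ↔-trans (size-walk n 0) (↔-sym (size-incTree n))
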